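{- Let $n\ge 3$. For $i\ge 2$ let $c_i$ be the number of connected plane geometric graphs on $i$ points in convex position, and for $j\ge 2$ let $a_{j} = \sum_{i=2}^{j} \binom{j-2}{i-2}c_{i}$. The $n\times n$ matrix $$R_{n} = \begin{pmatrix} 0 & a_{2} & a_{3} & a_{4} & a_{5} & \cdots & a_{n} \\ 1 & 0 & a_{2} & a_{3} & a_{4} & \cdots & a_{n-1} \\ 0 & 1 & 0 & a_{2} & a_{3} & \cdots & a_{n-2} \\ 0 & 0 & 1 & 0 & a_{2} & \cdots & a_{n-3} \\ 0 & 0 & 0 & 1 & 0 & \cdots & a_{n-4} \\ \vdots & \vdots & \vdots & \vdots & \vdots & \ddots & \vdots \\ 0 & 0 & 0 & 0 & 0 & \cdots & 0 \end{pmatrix}$$ (whose $(p,q)$ entry is $a_{q-p+1}$ if $q>p$, $0$ if $q=p$, $1$ if $q=p-1$, and $0$ if $q<p-1$) is a production matrix for plane geometric graphs of point sets in convex position; that is, $v^{i+1}=R_n v^i$ for all $i\ge 1$ with $i+2\le n$.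
   Context: A geometric graph on a finite point set $\mathcal S\subseteq\mathbb R^2$ has vertex set $\mathcal S$ and edges that are straight-line segments with endpoints in $\mathcal S$; it is plane if no two edges intersect except at common endpoints. Graphs with $i$ vertices are considered on points $p_1,\dots,p_i$ in convex position labelled in counter-clockwise order. Two vertices are visible (from each other) if the line segment connecting them does not intersect the interior of any edge of the graph. The isolation degree of the root vertex $p_i$ of a graph on $\{p_1,\dots,p_i\}$ is the number of isolated vertices (vertices with no incident edge) of the graph that are visible from an additional vertex $p_{i+1}$ inserted between $p_i$ and $p_1$ in convex position; it is between $0$ and $i$. For $1\le i\le n-1$, $v^i$ is the $n$-dimensional column vector whose $j$-th entry is the number of plane geometric graphs on $i$ points in convex position whose root vertex has isolation degree $j-1$ (so $v^1=(0,1,0,\dots,0)^\top$). A production matrix is a matrix satisfying $v^{i+1}=R_nv^i$. -}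

module Defs where

open import Algebra.Bundles using (CommutativeRing)
import Algebra.Properties.Semiring.Sum as SemiringSum
open import Data.Bool.Base using (if_then_else_)
open import Data.Empty using (⊥)
open import Data.Fin.Base as Fin using (Fin; zero; suc; toℕ; inject₁; fromℕ)
open import Data.Fin.Subset using (Subset) renaming (_∈_ to _∈ˢ_)
open import Data.List.Base using (List; length)
open import Data.List.Membership.Propositional using (_∈_)
open import Data.List.Relation.Unary.Unique.Propositional using (Unique)
open import Data.Nat.Base using (ℕ; zero; suc; _+_; _*_; _∸_)
open import Data.Nat.Combinatorics using (_C_)
open import Data.Nat.Properties using (_<?_; _≟_; +-*-semiring)
open import Data.Product.Base using (_×_; _,_; ∃-syntax)
open import Data.Sum.Base using (_⊎_)
open import Data.Vec.Functional using (Vector)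
open import Function.Base using (_∘_)
open import Function.Bundles using (_⇔_)
open import Level using (Level; _⊔_) renaming (suc to lsuc)
open import Relation.Binary.Construct.Closure.ReflexiveTransitive using (Star)
open import Relation.Binary.Core using (Rel)
open import Relation.Binary.PropositionalEquality using (_≡_)
open import Relation.Binary.Structures using (IsStrictTotalOrder)
open import Relation.Nullary using (¬_; does)
open import Relation.Unary using (Pred)

open SemiringSum +-*-semiring using (sum-syntax)

-- The number of elements satisfying P is k.
_HasSize_ : ∀ {a p} {A : Set a} → Pred A p → ℕ → Set (a ⊔ p)
_HasSize_ {A = A} P k =
  ∃[ xs ] Unique xs × (∀ (x : A) → x ∈ xs ⇔ P x) × length xs ≡ k

-- Simple graphs on the vertex set Fin i, each represented exactly once, so
-- that _≡_ is equality of edge sets: N ◁ G adds a new vertex zero to G, whose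
-- set of neighbours is N, and renames the vertices of G by suc.
infixr 5 _◁_

data Graph : ℕ → Set where
  ∅   : Graph 0
  _◁_ : ∀ {i} → Subset i → Graph i → Graph (suc i)

Adjacent : ∀ {i} → Graph i → Fin i → Fin i → Set
Adjacent (N ◁ G) zero    zero    = ⊥
Adjacent (N ◁ G) zero    (suc b) = b ∈ˢ N
Adjacent (N ◁ G) (suc a) zero    = a ∈ˢ N
Adjacent (N ◁ G) (suc a) (suc b) = Adjacent G a b

Connected : ∀ {i} → Graph i → Set
Connected G = ∀ a b → Star (Adjacent G) a b

Isolated : ∀ {i} → Graph i → Fin i → Set
Isolated G a = ∀ b → ¬ Adjacent G a b

-- Coordinates are taken in an arbitrary linearly ordered field.
record OrderedField c ℓ₁ ℓ₂ : Set (lsuc (c ⊔ ℓ₁ ⊔ ℓ₂)) where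
  infix 4 _<_
  field
    commutativeRing : CommutativeRing c ℓ₁
  open CommutativeRing commutativeRing public
    renaming (_+_ to _+ᶠ_; _*_ to _*ᶠ_; _-_ to _-ᶠ_)
  field
    _<_                : Rel Carrier ℓ₂
    isStrictTotalOrder : IsStrictTotalOrder _≈_ _<_
    0<1                : 0# < 1#
    +-monoˡ-<          : ∀ {x y} z → x < y → (x +ᶠ z) < (y +ᶠ z)
    *-positive         : ∀ {x y} → 0# < x → 0# < y → 0# < (x *ᶠ y)
    inverse            : ∀ x → ¬ (x ≈ 0#) → ∃[ y ] (x *ᶠ y) ≈ 1#

  infix 4 _≤_
  _≤_ : Rel Carrier (ℓ₁ ⊔ ℓ₂)
  x ≤ y = x < y ⊎ x ≈ y

module Plane {c ℓ₁ ℓ₂} (F : OrderedField c ℓ₁ ℓ₂) where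
  open OrderedField F

  Point : Set c
  Point = Carrier × Carrier

  infix 4 _≋_
  _≋_ : Point → Point → Set ℓ₁
  (x , y) ≋ (x′ , y′) = x ≈ x′ × y ≈ y′

  -- The point A + t (B - A).
  along : Point → Point → Carrier → Point
  along (x , y) (x′ , y′) t = (x +ᶠ t *ᶠ (x′ -ᶠ x)) , (y +ᶠ t *ᶠ (y′ -ᶠ y))

  OnSegment : Point → Point → Point → Set (c ⊔ ℓ₁ ⊔ ℓ₂)
  OnSegment A B X = ∃[ t ] 0# ≤ t × t ≤ 1# × X ≋ along A B t

  InInterior : Point → Point → Point → Set (c ⊔ ℓ₁ ⊔ ℓ₂)
  InInterior A B X = ∃[ t ] 0# < t × t < 1# × X ≋ along A B t

  -- A, B, C make a left turn.
  CCW : Point → Point → Point → Set ℓ₂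
  CCW (x₁ , y₁) (x₂ , y₂) (x₃ , y₃) =
    ((x₃ -ᶠ x₁) *ᶠ (y₂ -ᶠ y₁)) < ((x₂ -ᶠ x₁) *ᶠ (y₃ -ᶠ y₁))

  -- Points in convex position, labelled in counter-clockwise order.
  -- Distinctness only has content for two points, where ccw is vacuous.
  record ConvexPosition {m} (p : Vector Point m) : Set (ℓ₁ ⊔ ℓ₂) where
    field
      distinct : ∀ {a b} → p a ≋ p b → a ≡ b
      ccw      : ∀ {a b d} → a Fin.< b → b Fin.< d → CCW (p a) (p b) (p d)

  -- Every common point of two different edges is a common endpoint of them.
  PlaneGraph : ∀ {i} → Vector Point i → Graph i → Set (c ⊔ ℓ₁ ⊔ ℓ₂)
  PlaneGraph p G =
    ∀ {a b a′ b′} → Adjacent G a b → Adjacent G a′ b′ →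
    ¬ ((a ≡ a′ × b ≡ b′) ⊎ (a ≡ b′ × b ≡ a′)) →
    ∀ X → OnSegment (p a) (p b) X → OnSegment (p a′) (p b′) X →
    ∃[ e ] (e ≡ a ⊎ e ≡ b) × (e ≡ a′ ⊎ e ≡ b′) × X ≋ p e

  VisibleFrom : ∀ {i} → Vector Point i → Graph i → Point → Fin i → Set (c ⊔ ℓ₁ ⊔ ℓ₂)
  VisibleFrom p G q x =
    ∀ {a b} → Adjacent G a b →
    ¬ (∃[ X ] OnSegment q (p x) X × InInterior (p a) (p b) X)

  -- p lists i + 1 points: G lives on the first i, and the last one is the
  -- additional vertex between the root (the i-th point) and the first point.
  HasIsolationDegree : ∀ {i} → Vector Point (suc i) → Graph i → ℕ → Set (c ⊔ ℓ₁ ⊔ ℓ₂)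
  HasIsolationDegree {i} p G d =
    (λ x → Isolated G x × VisibleFrom (p ∘ inject₁) G (p (fromℕ i)) x) HasSize d

  -- The graphs counted by cᵢ.
  ConnectedPlane : ∀ {i} → Vector Point i → Pred (Graph i) (c ⊔ ℓ₁ ⊔ ℓ₂)
  ConnectedPlane p G = PlaneGraph p G × Connected G

  -- The graphs counted by the entries of vⁱ.
  PlaneOfDegree : ∀ {i} → Vector Point (suc i) → ℕ → Pred (Graph i) (c ⊔ ℓ₁ ⊔ ℓ₂)
  PlaneOfDegree p d G = PlaneGraph (p ∘ inject₁) G × HasIsolationDegree p G d

-- a_j for j ≥ 2; the summation index i of the usual formula is 2 + k.
coeff : (ℕ → ℕ) → ℕ → ℕ
coeff c j = ∑[ k < j ∸ 1 ] (((j ∸ 2) C toℕ k) * c (2 + toℕ k))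

-- Rows and columns are numbered from 0; the entries depend only on q - p.
R : (ℕ → ℕ) → ∀ n → Fin n → Fin n → ℕ
R c n p q =
  if does (toℕ p <? toℕ q) then coeff c ((toℕ q ∸ toℕ p) + 1) else
  if does (toℕ p ≟ suc (toℕ q)) then 1 else 0

infixr 7 _·_
_·_ : ∀ {n} → (Fin n → Fin n → ℕ) → Vector ℕ n → Vector ℕ n
_·_ {n} M v p = ∑[ q < n ] (M p q * v q)

{-# OPTIONS --safe #-}

-- The orientation of p a, p b, p x depends only on the cyclic order of a, b, x.
-- Hence a graph is plane iff no two edges a c and b d have a < b < c < d, and
-- an isolated vertex x is visible from the additional vertex iff no edge a b
-- has a < x < b; call such vertices exposed.  These conditions do not
-- distinguish the two ends of the list of points, so a new vertex may be added
-- in front as zero instead of at the end.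
--
-- Let S be the component of zero (without zero) in a plane graph G, and let G′
-- be what remains of G when zero and all edges at S are removed.  Then S
-- consists of exposed vertices of G′, and G is recovered from G′, S and the
-- connected plane graph that G induces on zero and S; every such triple
-- occurs.  The exposed vertices of G are those of G′ beyond all of S, and zero
-- if S is empty.  If G′ has q exposed vertices and G has p, then either S is
-- empty and p = q + 1, or the last vertex of S is determined by p and the
-- others are chosen freely among the q - p - 1 exposed vertices before it.
module Submission where

open import Defs
open import Algebra.Bundles using (CommutativeRing)
import Algebra.Properties.AbelianGroup
import Algebra.Properties.Ring
import Algebra.Properties.Semiring.Mult.TCOptimised
import Algebra.Properties.Semiring.Sum as SemiringSum
import Algebra.Solver.Ring
open import Algebra.Solver.Ring.AlmostCommutativeRing using (_-Raw-AlmostCommutative⟶_; fromCommutativeRing)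
open import Data.Bool.Base using (if_then_else_)
open import Data.Empty using (⊥-elim)
open import Data.Fin.Base as Fin using (Fin; zero; suc; toℕ; inject₁; fromℕ)
import Data.Fin.Properties as Fin
open import Data.Fin.Subset as Subset using (Subset; inside; outside; ∣_∣; Nonempty)
  renaming (_∈_ to _∈ˢ_; ⊥ to ∅ˢ; _⊆_ to _⊆ˢ_)
import Data.Fin.Subset.Properties as Subset
open import Data.Integer.Base as ℤ using (ℤ; -[1+_]; _⊖_; _◃_)
import Data.Integer.Properties as ℤ
open import Data.List.Base as List using (List; []; _∷_; _++_; length; allFin)
import Data.List.Properties as List
open import Data.List.Membership.Propositional using (_∈_)
open import Data.List.Membership.Propositional.Properties
  using (∈-map⁺; ∈-map⁻; ∈-++⁺ˡ; ∈-++⁺ʳ; ∈-++⁻; ∈-allFin)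
open import Data.List.Membership.Propositional.Properties.WithK using (unique∧set⇒bag)
open import Data.List.Relation.Binary.BagAndSetEquality using (∼bag⇒↭)
open import Data.List.Relation.Binary.Permutation.Propositional.Properties using (↭-length)
open import Data.List.Relation.Unary.All as All using ([]; _∷_)
open import Data.List.Relation.Unary.AllPairs using ([]; _∷_)
open import Data.List.Relation.Unary.Any using (here; there)
open import Data.List.Relation.Unary.Unique.Propositional using (Unique)
import Data.List.Relation.Unary.Unique.Propositional.Properties as Unique
open import Data.Maybe.Base using (Maybe; just; nothing)
open import Data.Nat.Base as ℕ using (ℕ; zero; suc)
open import Data.Nat.ListAction using (sum)
open import Data.Nat.ListAction.Properties using (sum-++)
import Data.Nat.Properties as ℕ
open import Data.Product.Base using (_×_; _,_; ∃-syntax; proj₁; proj₂; map₂)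
import Data.Sign.Base as Sign
open import Data.Sum.Base using (_⊎_; inj₁; inj₂; [_,_]′)
open import Data.Unit.Base using (⊤; tt)
open import Data.Vec.Base as Vec using ([]; _∷_; here; there)
open import Data.Vec.Functional using (Vector)
import Data.Vec.Properties as Vec
open import Function.Base using (_∘_; const; id)
open import Function.Bundles using (_⇔_; mk⇔; Equivalence)
open import Function.Construct.Composition using (_⇔-∘_)
open import Function.Construct.Symmetry using (⇔-sym)
open import Level using (_⊔_)
open import Relation.Binary.Construct.Closure.ReflexiveTransitive as Star using (Star; ε; _◅_; _◅◅_)
open import Relation.Binary.Definitions using (tri<; tri≈; tri>; Symmetric; Irreflexive)
import Relation.Binary.PropositionalEquality as ≡
open import Relation.Binary.PropositionalEquality using (_≡_; _≢_)
import Relation.Binary.Reasoning.Setoid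
open import Relation.Binary.Structures using (IsStrictTotalOrder)
open import Relation.Nullary using (¬_; Dec; yes; no; does)
open import Relation.Nullary.Decidable using (dec-true; dec-false; _×-dec_; _⊎-dec_; ¬?; map′)
open import Relation.Unary using (Pred; Decidable)

-- Orientation of points over an ordered field

module IntegerCoefficients {r ℓ} (Rg : CommutativeRing r ℓ) where
  open CommutativeRing Rg
  open Algebra.Properties.Ring ring
  open Algebra.Properties.AbelianGroup +-abelianGroup using (⁻¹-∙-comm; ⁻¹-involutive; ε⁻¹≈ε)
  open Algebra.Properties.Semiring.Mult.TCOptimised semiring using (×-homo-+; ×1-homo-*; 1+×) renaming (_×_ to _×ᴿ_)
  open Relation.Binary.Reasoning.Setoid setoid

  -- The canonical homomorphism from the integers. It gives the ring solver coefficients whose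
  -- equality is decided by computation, as cancellation requires, over an arbitrary commutative
  -- ring.
  ⟦_⟧ℤ : ℤ → Carrier
  ⟦ ℤ.+ n    ⟧ℤ = n ×ᴿ 1#
  ⟦ -[1+ n ] ⟧ℤ = - (suc n ×ᴿ 1#)

  ⟦⊖⟧ : ∀ m n → ⟦ m ⊖ n ⟧ℤ ≈ m ×ᴿ 1# - n ×ᴿ 1#
  ⟦⊖⟧ m zero = sym (trans (+-congˡ ε⁻¹≈ε) (+-identityʳ _))
  ⟦⊖⟧ zero (suc n) = sym (+-identityˡ _)
  ⟦⊖⟧ (suc m) (suc n) = begin
    ⟦ suc m ⊖ suc n ⟧ℤ                  ≡⟨ ≡.cong ⟦_⟧ℤ (ℤ.[1+m]⊖[1+n]≡m⊖n m n) ⟩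
    ⟦ m ⊖ n ⟧ℤ                          ≈⟨ ⟦⊖⟧ m n ⟩
    m ×ᴿ 1# - n ×ᴿ 1#                     ≈⟨ +-congʳ (+-identityʳ _) ⟨
    m ×ᴿ 1# + 0# - n ×ᴿ 1#                ≈⟨ +-congʳ (+-congˡ (-‿inverseʳ 1#)) ⟨
    m ×ᴿ 1# + (1# - 1#) - n ×ᴿ 1#         ≈⟨ +-congʳ (+-assoc _ _ _) ⟨
    m ×ᴿ 1# + 1# - 1# - n ×ᴿ 1#           ≈⟨ +-assoc _ _ _ ⟩
    m ×ᴿ 1# + 1# + (- 1# - n ×ᴿ 1#)       ≈⟨ +-cong (+-comm _ _) (⁻¹-∙-comm _ _) ⟩
    1# + m ×ᴿ 1# - (1# + n ×ᴿ 1#)         ≈⟨ +-cong (1+× m 1#) (-‿cong (1+× n 1#)) ⟨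
    suc m ×ᴿ 1# - suc n ×ᴿ 1#             ∎

  ⟦-⟧ : ∀ i → ⟦ ℤ.- i ⟧ℤ ≈ - ⟦ i ⟧ℤ
  ⟦-⟧ (ℤ.+ zero)  = sym ε⁻¹≈ε
  ⟦-⟧ (ℤ.+ suc n) = refl
  ⟦-⟧ -[1+ n ]  = sym (⁻¹-involutive _)

  ⟦+⟧ : ∀ i j → ⟦ i ℤ.+ j ⟧ℤ ≈ ⟦ i ⟧ℤ + ⟦ j ⟧ℤ
  ⟦+⟧ (ℤ.+ m)    (ℤ.+ n)    = ×-homo-+ 1# m n
  ⟦+⟧ (ℤ.+ m)    -[1+ n ] = ⟦⊖⟧ m (suc n)
  ⟦+⟧ -[1+ m ] (ℤ.+ n)    = trans (⟦⊖⟧ n (suc m)) (+-comm _ _)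
  ⟦+⟧ -[1+ m ] -[1+ n ] = begin
    - (suc (suc (m ℕ.+ n)) ×ᴿ 1#)         ≡⟨ ≡.cong (λ k → - (suc k ×ᴿ 1#)) (ℕ.+-suc m n) ⟨
    - ((suc m ℕ.+ suc n) ×ᴿ 1#)           ≈⟨ -‿cong (×-homo-+ 1# (suc m) (suc n)) ⟩
    - (suc m ×ᴿ 1# + suc n ×ᴿ 1#)          ≈⟨ ⁻¹-∙-comm _ _ ⟨
    - (suc m ×ᴿ 1#) - suc n ×ᴿ 1#          ∎

  ⟦-◃⟧ : ∀ n → ⟦ Sign.- ◃ n ⟧ℤ ≈ - (n ×ᴿ 1#)
  ⟦-◃⟧ n = trans (reflexive (≡.cong ⟦_⟧ℤ (ℤ.-◃n≡-n n))) (⟦-⟧ (ℤ.+ n))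

  ⟦*⟧ : ∀ i j → ⟦ i ℤ.* j ⟧ℤ ≈ ⟦ i ⟧ℤ * ⟦ j ⟧ℤ
  ⟦*⟧ (ℤ.+ m)    (ℤ.+ n)    = trans (reflexive (≡.cong ⟦_⟧ℤ (ℤ.+◃n≡+n (m ℕ.* n)))) (×1-homo-* m n)
  ⟦*⟧ (ℤ.+ m)    -[1+ n ] = begin
    ⟦ Sign.- ◃ (m ℕ.* suc n) ⟧ℤ  ≈⟨ ⟦-◃⟧ (m ℕ.* suc n) ⟩
    - ((m ℕ.* suc n) ×ᴿ 1#)       ≈⟨ -‿cong (×1-homo-* m (suc n)) ⟩
    - (m ×ᴿ 1# * suc n ×ᴿ 1#)      ≈⟨ -‿distribʳ-* _ _ ⟩
    m ×ᴿ 1# * - (suc n ×ᴿ 1#)      ∎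
  ⟦*⟧ -[1+ m ] (ℤ.+ n)    = begin
    ⟦ Sign.- ◃ (suc m ℕ.* n) ⟧ℤ  ≈⟨ ⟦-◃⟧ (suc m ℕ.* n) ⟩
    - ((suc m ℕ.* n) ×ᴿ 1#)       ≈⟨ -‿cong (×1-homo-* (suc m) n) ⟩
    - (suc m ×ᴿ 1# * n ×ᴿ 1#)      ≈⟨ -‿distribˡ-* _ _ ⟩
    - (suc m ×ᴿ 1#) * n ×ᴿ 1#      ∎
  ⟦*⟧ -[1+ m ] -[1+ n ] = begin
    (suc m ℕ.* suc n) ×ᴿ 1#           ≈⟨ ×1-homo-* (suc m) (suc n) ⟩
    suc m ×ᴿ 1# * suc n ×ᴿ 1#          ≈⟨ ⁻¹-involutive _ ⟨
    - - (suc m ×ᴿ 1# * suc n ×ᴿ 1#)    ≈⟨ -‿cong (-‿distribˡ-* _ _) ⟩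
    - (- (suc m ×ᴿ 1#) * suc n ×ᴿ 1#)  ≈⟨ -‿distribʳ-* _ _ ⟩
    - (suc m ×ᴿ 1#) * - (suc n ×ᴿ 1#)  ∎

  morphism : ℤ.+-*-rawRing -Raw-AlmostCommutative⟶ fromCommutativeRing Rg
  morphism = record
    { ⟦_⟧ = ⟦_⟧ℤ ; +-homo = ⟦+⟧ ; *-homo = ⟦*⟧ ; -‿homo = ⟦-⟧ ; 0-homo = refl ; 1-homo = refl }

  coeff≟ : ∀ i j → Maybe (⟦ i ⟧ℤ ≈ ⟦ j ⟧ℤ)
  coeff≟ i j with i ℤ.≟ j
  ... | yes ≡.refl = just refl
  ... | no _       = nothing

  open Algebra.Solver.Ring ℤ.+-*-rawRing (fromCommutativeRing Rg) morphism coeff≟ public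
    using (solve; con; _:=_; _:+_; _:*_; _:-_; :-_)

module OrderedFieldProperties {c ℓ₁ ℓ₂} (F : OrderedField c ℓ₁ ℓ₂) where
  open OrderedField F
  open IntegerCoefficients commutativeRing
  open IsStrictTotalOrder isStrictTotalOrder public
    using (compare; <-respʳ-≈; <-respˡ-≈)
    renaming (irrefl to <-irrefl; trans to <-trans)

  <⇒0<- : ∀ {x y} → x < y → 0# < (y -ᶠ x)
  <⇒0<- {x} x<y = <-respˡ-≈ (-‿inverseʳ x) (+-monoˡ-< (- x) x<y)

  0<-⇒< : ∀ {x y} → 0# < (y -ᶠ x) → x < y
  0<-⇒< {x} {y} 0<y-x = <-respˡ-≈ (+-identityˡ x)
    (<-respʳ-≈ (solve 2 (λ x y → y :- x :+ x := y) refl x y) (+-monoˡ-< x 0<y-x))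

  +-positive : ∀ {x y} → 0# < x → 0# < y → 0# < (x +ᶠ y)
  +-positive {x} {y} 0<x 0<y = <-trans 0<y (<-respˡ-≈ (+-identityˡ y) (+-monoˡ-< y 0<x))

  -- If `y` were negative, `x * (0 - y)`, which equals `0 - 1`, would be positive, and adding
  -- `0 < 1` would give `0 < 0`. If `y` were zero, so would be `1`.
  inverse-positive : ∀ {x y} → 0# < x → (x *ᶠ y) ≈ 1# → 0# < y
  inverse-positive {x} {y} 0<x xy≈1 with compare 0# y
  ... | tri< 0<y _ _ = 0<y
  ... | tri≈ _ 0≈y _ = ⊥-elim (<-irrefl (trans (sym (zeroʳ x)) (trans (*-congˡ 0≈y) xy≈1)) 0<1)
  ... | tri> _ _ y<0 = ⊥-elim (<-irrefl 0≈-1+1 (+-positive 0<-1 0<1))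
    where
    0<-1 : 0# < (0# -ᶠ 1#)
    0<-1 = <-respʳ-≈ (trans (solve 2 (λ x y → x :* (con (ℤ.+ 0) :- y) := con (ℤ.+ 0) :- x :* y) refl x y)
                            (+-congˡ (-‿cong xy≈1)))
                     (*-positive 0<x (<⇒0<- y<0))
    0≈-1+1 : 0# ≈ ((0# -ᶠ 1#) +ᶠ 1#)
    0≈-1+1 = solve 0 (con (ℤ.+ 0) := con (ℤ.+ 0) :- con (ℤ.+ 1) :+ con (ℤ.+ 1)) refl

  -- Strictly between the ends both products are positive. At an end one of them vanishes and the
  -- other is `x` or `y` itself, hence the separate cases.
  convex-positive : ∀ {t x y} → 0# ≤ t → t ≤ 1# → 0# < x → 0# < y →
                    0# < ((1# -ᶠ t) *ᶠ x +ᶠ t *ᶠ y)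
  convex-positive {t} {x} {y} (inj₂ 0≈t) _ 0<x _ = <-respʳ-≈
    (trans (solve 2 (λ x y → x := (con (ℤ.+ 1) :- con (ℤ.+ 0)) :* x :+ con (ℤ.+ 0) :* y) refl x y)
           (+-cong (*-congʳ (+-congˡ (-‿cong 0≈t))) (*-congʳ 0≈t))) 0<x
  convex-positive {t} {x} {y} (inj₁ 0<t) (inj₂ t≈1) 0<x 0<y = <-respʳ-≈
    (trans (solve 2 (λ x y → y := (con (ℤ.+ 1) :- con (ℤ.+ 1)) :* x :+ con (ℤ.+ 1) :* y) refl x y)
           (+-cong (*-congʳ (+-congˡ (-‿cong (sym t≈1)))) (*-congʳ (sym t≈1)))) 0<y
  convex-positive (inj₁ 0<t) (inj₁ t<1) 0<x 0<y =
    +-positive (*-positive (<⇒0<- t<1) 0<x) (*-positive 0<t 0<y)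

  -- Here `δ` is the inverse of `x + y`; the upper bound holds because `1 - x δ = y δ` is positive.
  ratio-in-unit-interval : ∀ {x y δ} → 0# < x → 0# < y → ((x +ᶠ y) *ᶠ δ) ≈ 1# →
                           0# < (x *ᶠ δ) × (x *ᶠ δ) < 1#
  ratio-in-unit-interval {x} {y} {δ} 0<x 0<y eq =
    *-positive 0<x 0<δ ,
    0<-⇒< (<-respʳ-≈ (trans (solve 3 (λ x y δ → y :* δ := (x :+ y) :* δ :- x :* δ) refl x y δ) (+-congʳ eq))
                     (*-positive 0<y 0<δ))
    where
    0<δ : 0# < δ
    0<δ = inverse-positive (+-positive 0<x 0<y) eq

module Segments {c ℓ₁ ℓ₂} (F : OrderedField c ℓ₁ ℓ₂) where
  open OrderedField F
  open OrderedFieldProperties F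
  open Plane F
  open IntegerCoefficients commutativeRing
  open Relation.Binary.Reasoning.Setoid setoid

  -- Twice the signed area of the triangle, written as the difference of the two sides of `CCW`, so
  -- that a left turn is positivity of `orient`.
  orient : Point → Point → Point → Carrier
  orient (x₁ , y₁) (x₂ , y₂) (x₃ , y₃) = (x₂ -ᶠ x₁) *ᶠ (y₃ -ᶠ y₁) -ᶠ (x₃ -ᶠ x₁) *ᶠ (y₂ -ᶠ y₁)

  private
    :orient = λ {n} x₁ y₁ x₂ y₂ x₃ y₃ → _:-_ {n} ((x₂ :- x₁) :* (y₃ :- y₁)) ((x₃ :- x₁) :* (y₂ :- y₁))

  orient-rotate : ∀ A B C → orient A B C ≈ orient B C A
  orient-rotate (x₁ , y₁) (x₂ , y₂) (x₃ , y₃) =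
    solve 6 (λ x₁ y₁ x₂ y₂ x₃ y₃ → :orient x₁ y₁ x₂ y₂ x₃ y₃ := :orient x₂ y₂ x₃ y₃ x₁ y₁)
      refl x₁ y₁ x₂ y₂ x₃ y₃

  orient-repeat₁ : ∀ A B → orient A B A ≈ 0#
  orient-repeat₁ (x₁ , y₁) (x₂ , y₂) =
    solve 4 (λ x₁ y₁ x₂ y₂ → :orient x₁ y₁ x₂ y₂ x₁ y₁ := con (ℤ.+ 0)) refl x₁ y₁ x₂ y₂

  orient-repeat₂ : ∀ A B → orient A B B ≈ 0#
  orient-repeat₂ A B = trans (trans (orient-rotate A B B) (orient-rotate B B A)) (orient-repeat₁ B A)

  orient-congʳ : ∀ A B {X Y} → X ≋ Y → orient A B X ≈ orient A B Y
  orient-congʳ (x₁ , y₁) (x₂ , y₂) (x≈ , y≈) =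
    +-cong (*-congˡ (+-congʳ y≈)) (-‿cong (*-congʳ (+-congʳ x≈)))

  -- `orient A B` is affine in its third argument. As it vanishes on the segment `A B`, this
  -- controls how another segment can meet that one.
  orient-along : ∀ A B C D t → orient A B (along C D t) ≈
                 ((1# -ᶠ t) *ᶠ orient A B C +ᶠ t *ᶠ orient A B D)
  orient-along (x₁ , y₁) (x₂ , y₂) (x₃ , y₃) (x₄ , y₄) t =
    solve 9 (λ x₁ y₁ x₂ y₂ x₃ y₃ x₄ y₄ t →
        :orient x₁ y₁ x₂ y₂ (x₃ :+ t :* (x₄ :- x₃)) (y₃ :+ t :* (y₄ :- y₃)) :=
        (con (ℤ.+ 1) :- t) :* :orient x₁ y₁ x₂ y₂ x₃ y₃ :+ t :* :orient x₁ y₁ x₂ y₂ x₄ y₄)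
      refl x₁ y₁ x₂ y₂ x₃ y₃ x₄ y₄ t

  along-0 : ∀ A B → along A B 0# ≋ A
  along-0 (x₁ , y₁) (x₂ , y₂) = lemma x₁ x₂ , lemma y₁ y₂
    where
    lemma : ∀ x y → (x +ᶠ 0# *ᶠ (y -ᶠ x)) ≈ x
    lemma x y = trans (+-congˡ (zeroˡ _)) (+-identityʳ x)

  along-swap : ∀ A B t → along A B t ≋ along B A (1# -ᶠ t)
  along-swap (x₁ , y₁) (x₂ , y₂) t = lemma x₁ x₂ , lemma y₁ y₂
    where
    lemma : ∀ x y → (x +ᶠ t *ᶠ (y -ᶠ x)) ≈ (y +ᶠ (1# -ᶠ t) *ᶠ (x -ᶠ y))
    lemma x y = solve 3 (λ x y t → x :+ t :* (y :- x) := y :+ (con (ℤ.+ 1) :- t) :* (x :- y)) refl x y t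

  along-cong : ∀ A B {s t} → s ≈ t → along A B s ≋ along A B t
  along-cong A B s≈t = +-congˡ (*-congʳ s≈t) , +-congˡ (*-congʳ s≈t)

  ≋-trans : ∀ {A B C} → A ≋ B → B ≋ C → A ≋ C
  ≋-trans (a , b) (c , d) = trans a c , trans b d

  OnSegment-swap : ∀ {A B X} → OnSegment A B X → OnSegment B A X
  OnSegment-swap {A} {B} (t , 0≤t , t≤1 , eq) = 1# -ᶠ t , 0≤1-t t≤1 , 1-t≤1 0≤t , ≋-trans eq (along-swap A B t)
    where
    0≤1-t : t ≤ 1# → 0# ≤ (1# -ᶠ t)
    0≤1-t (inj₁ t<1) = inj₁ (<⇒0<- t<1)
    0≤1-t (inj₂ t≈1) = inj₂ (trans (sym (-‿inverseʳ 1#)) (+-congˡ (-‿cong (sym t≈1))))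
    1-t≤1 : 0# ≤ t → (1# -ᶠ t) ≤ 1#
    1-t≤1 (inj₁ 0<t) = inj₁ (0<-⇒< (<-respʳ-≈ (solve 1 (λ t → t := con (ℤ.+ 1) :- (con (ℤ.+ 1) :- t)) refl t) 0<t))
    1-t≤1 (inj₂ 0≈t) = inj₂ (trans (+-congˡ (-‿cong (sym 0≈t)))
      (solve 0 (con (ℤ.+ 1) :- con (ℤ.+ 0) := con (ℤ.+ 1)) refl))

  InInterior⇒OnSegment : ∀ {A B X} → InInterior A B X → OnSegment A B X
  InInterior⇒OnSegment (t , 0<t , t<1 , eq) = t , inj₁ 0<t , inj₁ t<1 , eq

  OnSegment⇒orient≈0 : ∀ {A B X} → OnSegment A B X → orient A B X ≈ 0#
  OnSegment⇒orient≈0 {A} {B} {X} (t , _ , _ , eq) = begin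
    orient A B X                                               ≈⟨ orient-congʳ A B eq ⟩
    orient A B (along A B t)                                   ≈⟨ orient-along A B A B t ⟩
    (1# -ᶠ t) *ᶠ orient A B A +ᶠ t *ᶠ orient A B B
      ≈⟨ +-cong (*-congˡ (orient-repeat₁ A B)) (*-congˡ (orient-repeat₂ A B)) ⟩
    (1# -ᶠ t) *ᶠ 0# +ᶠ t *ᶠ 0#                                 ≈⟨ +-cong (zeroʳ _) (zeroʳ _) ⟩
    0# +ᶠ 0#                                                   ≈⟨ +-identityˡ 0# ⟩
    0#                                                         ∎

  -- Along `C D` the orientation is a convex combination of two positive values, whereas it vanishes
  -- on `A B`.
  segment-misses-line : ∀ {A B C D X} → 0# < orient A B C → 0# < orient A B D →
                        OnSegment C D X → ¬ OnSegment A B X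
  segment-misses-line {A} {B} {C} {D} 0<C 0<D (t , 0≤t , t≤1 , eq) X∈AB =
    <-irrefl (sym (OnSegment⇒orient≈0 X∈AB))
      (<-respʳ-≈ (sym (trans (orient-congʳ A B eq) (orient-along A B C D t)))
                 (convex-positive 0≤t t≤1 0<C 0<D))

  -- Along `C D` the orientation is `t` times that of `D`, so it vanishes only at `t = 0`. This
  -- serves for edges with a common end `C`.
  segment-leaves-line : ∀ {A B C D X} → orient A B C ≈ 0# → 0# < orient A B D →
                        OnSegment C D X → OnSegment A B X → X ≋ C
  segment-leaves-line {A} {B} {C} {D} C≈0 0<D (t , inj₂ 0≈t , t≤1 , eq) X∈AB =
    ≋-trans eq (≋-trans (along-cong C D (sym 0≈t)) (along-0 C D))
  segment-leaves-line {A} {B} {C} {D} {X} C≈0 0<D (t , inj₁ 0<t , t≤1 , eq) X∈AB =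
    ⊥-elim (<-irrefl (sym tD≈0) (*-positive 0<t 0<D))
    where
    tD≈0 : (t *ᶠ orient A B D) ≈ 0#
    tD≈0 = begin
      t *ᶠ orient A B D                                  ≈⟨ +-identityˡ _ ⟨
      0# +ᶠ t *ᶠ orient A B D                            ≈⟨ +-congʳ (trans (*-congˡ C≈0) (zeroʳ _)) ⟨
      (1# -ᶠ t) *ᶠ orient A B C +ᶠ t *ᶠ orient A B D     ≈⟨ orient-along A B C D t ⟨
      orient A B (along C D t)                           ≈⟨ orient-congʳ A B eq ⟨
      orient A B X                                       ≈⟨ OnSegment⇒orient≈0 X∈AB ⟩
      0#                                                 ∎

  private
    -- Here `δ` is `1 / k`. Pulling it out turns equations that involve an inverse into polynomial
    -- identities for the ring solver.
    scale-out : ∀ {k δ x y u} → (k *ᶠ δ) ≈ 1# → (k *ᶠ x +ᶠ u *ᶠ y) *ᶠ δ ≈ x +ᶠ (u *ᶠ δ) *ᶠ y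
    scale-out {k} {δ} {x} {y} {u} kδ≈1 = begin
      (k *ᶠ x +ᶠ u *ᶠ y) *ᶠ δ
        ≈⟨ solve 5 (λ k δ x y u → (k :* x :+ u :* y) :* δ := (k :* δ) :* x :+ (u :* δ) :* y) refl k δ x y u ⟩
      (k *ᶠ δ) *ᶠ x +ᶠ (u *ᶠ δ) *ᶠ y   ≈⟨ +-congʳ (trans (*-congʳ kδ≈1) (*-identityˡ x)) ⟩
      x +ᶠ (u *ᶠ δ) *ᶠ y               ∎

  -- The diagonals of a convex quadrilateral of (doubled) area K meet at
  -- A + (ABD / K)(C - A) = B + (ABC / K)(D - B).
  diagonals-meet : ∀ A B C D → 0# < orient A B C → 0# < orient A B D →
                   0# < orient A C D → 0# < orient B C D →
                   ∃[ X ] InInterior A C X × InInterior B D X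
  diagonals-meet A@(x₁ , y₁) B@(x₂ , y₂) C@(x₃ , y₃) D@(x₄ , y₄) 0<ABC 0<ABD 0<ACD 0<BCD =
    along A C (orient A B D *ᶠ δ) ,
    (_ , proj₁ t-bounds , proj₂ t-bounds , refl , refl) ,
    (_ , proj₁ s-bounds , proj₂ s-bounds , same-x , same-y)
    where
    K : Carrier
    K = orient A B D +ᶠ orient B C D
    invertible : ∃[ δ ] (K *ᶠ δ) ≈ 1#
    invertible = inverse K (λ K≈0 → <-irrefl (sym K≈0) (+-positive 0<ABD 0<BCD))
    δ : Carrier
    δ = proj₁ invertible
    area : K ≈ (orient A B C +ᶠ orient A C D)
    area = solve 8 (λ x₁ y₁ x₂ y₂ x₃ y₃ x₄ y₄ →
        :orient x₁ y₁ x₂ y₂ x₄ y₄ :+ :orient x₂ y₂ x₃ y₃ x₄ y₄ :=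
        :orient x₁ y₁ x₂ y₂ x₃ y₃ :+ :orient x₁ y₁ x₃ y₃ x₄ y₄)
      refl x₁ y₁ x₂ y₂ x₃ y₃ x₄ y₄
    t-bounds : 0# < (orient A B D *ᶠ δ) × (orient A B D *ᶠ δ) < 1#
    t-bounds = ratio-in-unit-interval 0<ABD 0<BCD (proj₂ invertible)
    s-bounds : 0# < (orient A B C *ᶠ δ) × (orient A B C *ᶠ δ) < 1#
    s-bounds = ratio-in-unit-interval 0<ABC 0<ACD (trans (*-congʳ (sym area)) (proj₂ invertible))
    same-x : (x₁ +ᶠ (orient A B D *ᶠ δ) *ᶠ (x₃ -ᶠ x₁)) ≈ (x₂ +ᶠ (orient A B C *ᶠ δ) *ᶠ (x₄ -ᶠ x₂))
    same-x = begin
      x₁ +ᶠ (orient A B D *ᶠ δ) *ᶠ (x₃ -ᶠ x₁)       ≈⟨ scale-out (proj₂ invertible) ⟨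
      (K *ᶠ x₁ +ᶠ orient A B D *ᶠ (x₃ -ᶠ x₁)) *ᶠ δ  ≈⟨ *-congʳ (solve 8 (λ x₁ y₁ x₂ y₂ x₃ y₃ x₄ y₄ →
          (:orient x₁ y₁ x₂ y₂ x₄ y₄ :+ :orient x₂ y₂ x₃ y₃ x₄ y₄) :* x₁ :+ :orient x₁ y₁ x₂ y₂ x₄ y₄ :* (x₃ :- x₁) :=
          (:orient x₁ y₁ x₂ y₂ x₄ y₄ :+ :orient x₂ y₂ x₃ y₃ x₄ y₄) :* x₂ :+ :orient x₁ y₁ x₂ y₂ x₃ y₃ :* (x₄ :- x₂))
          refl x₁ y₁ x₂ y₂ x₃ y₃ x₄ y₄) ⟩
      (K *ᶠ x₂ +ᶠ orient A B C *ᶠ (x₄ -ᶠ x₂)) *ᶠ δ  ≈⟨ scale-out (proj₂ invertible) ⟩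
      x₂ +ᶠ (orient A B C *ᶠ δ) *ᶠ (x₄ -ᶠ x₂)       ∎
    same-y : (y₁ +ᶠ (orient A B D *ᶠ δ) *ᶠ (y₃ -ᶠ y₁)) ≈ (y₂ +ᶠ (orient A B C *ᶠ δ) *ᶠ (y₄ -ᶠ y₂))
    same-y = begin
      y₁ +ᶠ (orient A B D *ᶠ δ) *ᶠ (y₃ -ᶠ y₁)       ≈⟨ scale-out (proj₂ invertible) ⟨
      (K *ᶠ y₁ +ᶠ orient A B D *ᶠ (y₃ -ᶠ y₁)) *ᶠ δ  ≈⟨ *-congʳ (solve 8 (λ x₁ y₁ x₂ y₂ x₃ y₃ x₄ y₄ →
          (:orient x₁ y₁ x₂ y₂ x₄ y₄ :+ :orient x₂ y₂ x₃ y₃ x₄ y₄) :* y₁ :+ :orient x₁ y₁ x₂ y₂ x₄ y₄ :* (y₃ :- y₁) :=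
          (:orient x₁ y₁ x₂ y₂ x₄ y₄ :+ :orient x₂ y₂ x₃ y₃ x₄ y₄) :* y₂ :+ :orient x₁ y₁ x₂ y₂ x₃ y₃ :* (y₄ :- y₂))
          refl x₁ y₁ x₂ y₂ x₃ y₃ x₄ y₄) ⟩
      (K *ᶠ y₂ +ᶠ orient A B C *ᶠ (y₄ -ᶠ y₂)) *ᶠ δ  ≈⟨ scale-out (proj₂ invertible) ⟩
      y₂ +ᶠ (orient A B C *ᶠ δ) *ᶠ (y₄ -ᶠ y₂)       ∎

open import Data.Nat.Base using (_+_; _*_; _∸_; _≤_)
open import Data.Nat.Combinatorics using (_C_; nCk+nC[k+1]≡[n+1]C[k+1]; k>n⇒nCk≡0)
open ≡ using (refl; cong; cong₂; sym; trans; module ≡-Reasoning)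

-- Plane graphs on points in convex position

fromPred : ∀ {m p} {P : Pred (Fin m) p} → Decidable P → Subset m
fromPred P? = Vec.tabulate (does ∘ P?)

∈-fromPred⁺ : ∀ {m p} {P : Pred (Fin m) p} (P? : Decidable P) {x} → P x → x ∈ˢ fromPred P?
∈-fromPred⁺ P? {zero} px with P? zero
... | yes _ = here
... | no ¬p = ⊥-elim (¬p px)
∈-fromPred⁺ P? {suc x} px = there (∈-fromPred⁺ (P? ∘ suc) px)

∈-fromPred⁻ : ∀ {m p} {P : Pred (Fin m) p} (P? : Decidable P) {x} → x ∈ˢ fromPred P? → P x
∈-fromPred⁻ P? {zero} x∈ with P? zero
∈-fromPred⁻ P? {zero} here | yes px = px
∈-fromPred⁻ P? {suc x} (there x∈) = ∈-fromPred⁻ (P? ∘ suc) x∈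

Adjacent-sym : ∀ {m} (G : Graph m) → Symmetric (Adjacent G)
Adjacent-sym (N ◁ G) {zero}  {suc b} a~b = a~b
Adjacent-sym (N ◁ G) {suc a} {zero}  a~b = a~b
Adjacent-sym (N ◁ G) {suc a} {suc b} a~b = Adjacent-sym G a~b

Adjacent-irrefl : ∀ {m} (G : Graph m) → Irreflexive _≡_ (Adjacent G)
Adjacent-irrefl (N ◁ G) {suc a} refl a~a = Adjacent-irrefl G refl a~a

Adjacent? : ∀ {m} (G : Graph m) a b → Dec (Adjacent G a b)
Adjacent? (N ◁ G) zero    zero    = no λ ()
Adjacent? (N ◁ G) zero    (suc b) = b Subset.∈? N
Adjacent? (N ◁ G) (suc a) zero    = a Subset.∈? N
Adjacent? (N ◁ G) (suc a) (suc b) = Adjacent? G a b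

fromRelation : ∀ {m r} {R : Fin m → Fin m → Set r} → (∀ a b → Dec (R a b)) → Graph m
fromRelation {zero}  R? = ∅
fromRelation {suc m} R? = fromPred (R? zero ∘ suc) ◁ fromRelation (λ a b → R? (suc a) (suc b))

-- `fromRelation` consults `R` only at pairs with `a < b`; symmetry recovers the pairs with `a > b`,
-- and irreflexivity rules out the diagonal.
fromRelation⁺ : ∀ {m r} {R : Fin m → Fin m → Set r} (R? : ∀ a b → Dec (R a b)) →
                Symmetric R → Irreflexive _≡_ R → ∀ {a b} → R a b → Adjacent (fromRelation R?) a b
fromRelation⁺ R? sy ir {zero}  {zero}  rab = ir refl rab
fromRelation⁺ R? sy ir {zero}  {suc b} rab = ∈-fromPred⁺ (R? zero ∘ suc) rab
fromRelation⁺ R? sy ir {suc a} {zero}  rab = ∈-fromPred⁺ (R? zero ∘ suc) (sy rab)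
fromRelation⁺ R? sy ir {suc a} {suc b} rab = fromRelation⁺ (λ a b → R? (suc a) (suc b)) sy (ir ∘ ≡.cong suc) rab

fromRelation⁻ : ∀ {m r} {R : Fin m → Fin m → Set r} (R? : ∀ a b → Dec (R a b)) →
                Symmetric R → ∀ {a b} → Adjacent (fromRelation R?) a b → R a b
fromRelation⁻ R? sy {zero}  {suc b} a~b = ∈-fromPred⁻ (R? zero ∘ suc) a~b
fromRelation⁻ R? sy {suc a} {zero}  a~b = sy (∈-fromPred⁻ (R? zero ∘ suc) a~b)
fromRelation⁻ R? sy {suc a} {suc b} a~b = fromRelation⁻ (λ a b → R? (suc a) (suc b)) sy a~b

Graph-ext : ∀ {m} {G H : Graph m} → (∀ {a b} → Adjacent G a b → Adjacent H a b) →
            (∀ {a b} → Adjacent H a b → Adjacent G a b) → G ≡ H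
Graph-ext {G = ∅}     {∅}     G⇒H H⇒G = refl
Graph-ext {G = N ◁ G} {M ◁ H} G⇒H H⇒G = ≡.cong₂ _◁_
  (Subset.⊆-antisym (λ {x} → G⇒H {zero} {suc x}) (λ {x} → H⇒G {zero} {suc x}))
  (Graph-ext (λ {a} {b} → G⇒H {suc a} {suc b}) (λ {a} {b} → H⇒G {suc a} {suc b}))

NonCrossing : ∀ {m} → Graph m → Set
NonCrossing G = ∀ {a b c d} → a Fin.< b → b Fin.< c → c Fin.< d → Adjacent G a c → ¬ Adjacent G b d

Covered : ∀ {m} → Graph m → Fin m → Set
Covered G x = ∃[ a ] ∃[ b ] a Fin.< x × x Fin.< b × Adjacent G a b

Exposed : ∀ {m} → Graph m → Fin m → Set
Exposed G x = Isolated G x × ¬ Covered G x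

Exposed? : ∀ {m} (G : Graph m) → Decidable (Exposed G)
Exposed? G x = Fin.all? (λ b → ¬? (Adjacent? G x b)) ×-dec
  ¬? (Fin.any? λ a → Fin.any? λ b → (a Fin.<? x) ×-dec (x Fin.<? b) ×-dec Adjacent? G a b)

opaque
  exposed : ∀ {m} → Graph m → Subset m
  exposed G = fromPred (Exposed? G)

  exposed⁺ : ∀ {m} (G : Graph m) {x} → Exposed G x → x ∈ˢ exposed G
  exposed⁺ G = ∈-fromPred⁺ (Exposed? G)

  exposed⁻ : ∀ {m} (G : Graph m) {x} → x ∈ˢ exposed G → Exposed G x
  exposed⁻ G = ∈-fromPred⁻ (Exposed? G)

-- a, b, x occur in this cyclic order, so that p x is to the left of the line
-- from p a to p b.
LeftOf : ∀ {m} → Fin m → Fin m → Fin m → Set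
LeftOf a b x = (a Fin.< b × b Fin.< x) ⊎ (b Fin.< x × x Fin.< a) ⊎ (x Fin.< a × a Fin.< b)

LeftOf-total : ∀ {m} {a b x : Fin m} → a ≢ b → x ≢ a → x ≢ b → LeftOf a b x ⊎ LeftOf b a x
LeftOf-total {a = a} {b} {x} a≢b x≢a x≢b with Fin.<-cmp a b | Fin.<-cmp x a | Fin.<-cmp x b
... | tri≈ _ e _ | _ | _ = ⊥-elim (a≢b e)
... | _ | tri≈ _ e _ | _ = ⊥-elim (x≢a e)
... | _ | _ | tri≈ _ e _ = ⊥-elim (x≢b e)
... | tri< a<b _ _ | tri< x<a _ _ | _            = inj₁ (inj₂ (inj₂ (x<a , a<b)))
... | tri< a<b _ _ | tri> _ _ a<x | tri< x<b _ _ = inj₂ (inj₂ (inj₁ (a<x , x<b)))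
... | tri< a<b _ _ | tri> _ _ a<x | tri> _ _ b<x = inj₁ (inj₁ (a<b , b<x))
... | tri> _ _ b<a | _            | tri< x<b _ _ = inj₂ (inj₂ (inj₂ (x<b , b<a)))
... | tri> _ _ b<a | tri< x<a _ _ | tri> _ _ b<x = inj₁ (inj₂ (inj₁ (b<x , x<a)))
... | tri> _ _ b<a | tri> _ _ a<x | tri> _ _ b<x = inj₂ (inj₁ (b<a , a<x))

-- If `x` and `y` were on opposite sides of the edge `a b`, the cyclic order would be `a, y, b, x`.
-- Each of its four rotations into a linear order is a forbidden crossing; the other combinations of
-- cases contradict the order.
NonCrossing⇒same-side : ∀ {m} (G : Graph m) → NonCrossing G → ∀ {a b x y} → Adjacent G a b →
                        Adjacent G x y → LeftOf a b x → ¬ LeftOf b a y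
NonCrossing⇒same-side G nc {a} {b} {x} {y} a~b x~y = sides
  where
  b~a : Adjacent G b a
  b~a = Adjacent-sym G a~b
  y~x : Adjacent G y x
  y~x = Adjacent-sym G x~y
  sides : LeftOf a b x → ¬ LeftOf b a y
  sides (inj₁ (a<b , b<x))        (inj₁ (b<a , _))          = Fin.<-asym a<b b<a
  sides (inj₁ (a<b , b<x))        (inj₂ (inj₁ (a<y , y<b))) = nc a<y y<b b<x a~b y~x
  sides (inj₁ (a<b , b<x))        (inj₂ (inj₂ (_ , b<a)))   = Fin.<-asym a<b b<a
  sides (inj₂ (inj₁ (b<x , x<a))) (inj₁ (_ , a<y))          = nc b<x x<a a<y b~a x~y
  sides (inj₂ (inj₁ (b<x , x<a))) (inj₂ (inj₁ (a<y , y<b))) = Fin.<-asym (Fin.<-trans b<x x<a) (Fin.<-trans a<y y<b)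
  sides (inj₂ (inj₁ (b<x , x<a))) (inj₂ (inj₂ (y<b , _)))   = nc y<b b<x x<a y~x b~a
  sides (inj₂ (inj₂ (x<a , a<b))) (inj₁ (b<a , _))          = Fin.<-asym a<b b<a
  sides (inj₂ (inj₂ (x<a , a<b))) (inj₂ (inj₁ (a<y , y<b))) = nc x<a a<y y<b x~y a~b
  sides (inj₂ (inj₂ (x<a , a<b))) (inj₂ (inj₂ (_ , b<a)))   = Fin.<-asym a<b b<a

module ConvexPositionProperties {c ℓ₁ ℓ₂} (F : OrderedField c ℓ₁ ℓ₂) where
  open OrderedField F using (_<_; 0#)
  open OrderedFieldProperties F
  open Plane F
  open Segments F

  private
    ≈-sym = OrderedField.sym F
    ≈-trans = OrderedField.trans F

  module _ {m} {p : Vector Point m} (convex : ConvexPosition p) where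
    open ConvexPosition convex using (ccw)

    ccw-positive : ∀ {a b d} → a Fin.< b → b Fin.< d → 0# < orient (p a) (p b) (p d)
    ccw-positive a<b b<d = <⇒0<- (ccw a<b b<d)

    LeftOf-positive : ∀ {a b x} → LeftOf a b x → 0# < orient (p a) (p b) (p x)
    LeftOf-positive (inj₁ (a<b , b<x))        = ccw-positive a<b b<x
    LeftOf-positive (inj₂ (inj₁ (b<x , x<a))) = <-respʳ-≈ (≈-sym (orient-rotate _ _ _)) (ccw-positive b<x x<a)
    LeftOf-positive (inj₂ (inj₂ (x<a , a<b))) = <-respʳ-≈ (orient-rotate _ _ _) (ccw-positive x<a a<b)

    chords-meet : ∀ {a b c d} → a Fin.< b → b Fin.< c → c Fin.< d →
                  ∃[ X ] InInterior (p a) (p c) X × InInterior (p b) (p d) X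
    chords-meet a<b b<c c<d = diagonals-meet _ _ _ _
      (ccw-positive a<b b<c) (ccw-positive a<b (Fin.<-trans b<c c<d))
      (ccw-positive (Fin.<-trans a<b b<c) c<d) (ccw-positive b<c c<d)

    module _ (G : Graph m) where
      PlaneGraph⇒NonCrossing : PlaneGraph p G → NonCrossing G
      PlaneGraph⇒NonCrossing plane {a} {b} {c} {d} a<b b<c c<d a~c b~d =
        let X , X∈ac , X∈bd = chords-meet a<b b<c c<d
            e , e∈ac , e∈bd , _ = plane a~c b~d different X (InInterior⇒OnSegment X∈ac) (InInterior⇒OnSegment X∈bd)
        in disjoint e∈ac e∈bd
        where
        a<d : a Fin.< d
        a<d = Fin.<-trans a<b (Fin.<-trans b<c c<d)
        different : ¬ ((a ≡ b × c ≡ d) ⊎ (a ≡ d × c ≡ b))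
        different (inj₁ (a≡b , _)) = Fin.<-irrefl a≡b a<b
        different (inj₂ (a≡d , _)) = Fin.<-irrefl a≡d a<d
        disjoint : ∀ {e} → e ≡ a ⊎ e ≡ c → ¬ (e ≡ b ⊎ e ≡ d)
        disjoint (inj₁ refl) (inj₁ a≡b) = Fin.<-irrefl a≡b a<b
        disjoint (inj₁ refl) (inj₂ a≡d) = Fin.<-irrefl a≡d a<d
        disjoint (inj₂ refl) (inj₁ c≡b) = Fin.<-irrefl (≡.sym c≡b) b<c
        disjoint (inj₂ refl) (inj₂ c≡d) = Fin.<-irrefl c≡d c<d

      private
        on-line : ∀ {a b x} → x ≡ a ⊎ x ≡ b → OrderedField._≈_ F (orient (p a) (p b) (p x)) 0#
        on-line (inj₁ refl) = orient-repeat₁ _ _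
        on-line (inj₂ refl) = orient-repeat₂ _ _

        swap : ∀ {a b x : Fin m} → x ≡ a ⊎ x ≡ b → x ≡ b ⊎ x ≡ a
        swap = [ inj₂ , inj₁ ]′

        endpoint? : ∀ (a b x : Fin m) → (x ≡ a ⊎ x ≡ b) ⊎ (x ≢ a × x ≢ b)
        endpoint? a b x with x Fin.≟ a | x Fin.≟ b
        ... | yes e | _     = inj₁ (inj₁ e)
        ... | _     | yes e = inj₁ (inj₂ e)
        ... | no ≢a | no ≢b = inj₂ (≢a , ≢b)

      module _ (nc : NonCrossing G) where
        private
          -- `y` lies strictly on one side of the line through the edge, so the segment from `x`
          -- leaves that line at once. If `y` is on the right, the edge is reversed first.
          meet-at-common-end : ∀ {a b x y X} → Adjacent G a b → x ≡ a ⊎ x ≡ b → y ≢ a × y ≢ b →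
                               OnSegment (p a) (p b) X → OnSegment (p x) (p y) X → X ≋ p x
          meet-at-common-end a~b x∈ab (y≢a , y≢b) X∈ab X∈xy
            with LeftOf-total (λ { refl → Adjacent-irrefl G refl a~b }) y≢a y≢b
          ... | inj₁ left  = segment-leaves-line (on-line x∈ab) (LeftOf-positive left) X∈xy X∈ab
          ... | inj₂ right = segment-leaves-line (on-line (swap x∈ab)) (LeftOf-positive right) X∈xy (OnSegment-swap X∈ab)

          -- Ends on the same side keep `x y` off the line of `a b`; ends on opposite sides are
          -- excluded by `NonCrossing⇒same-side`.
          disjoint-edges-miss : ∀ {a b x y X} → Adjacent G a b → Adjacent G x y → x ≢ a × x ≢ b → y ≢ a × y ≢ b →
                                OnSegment (p a) (p b) X → ¬ OnSegment (p x) (p y) X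
          disjoint-edges-miss a~b x~y (x≢a , x≢b) (y≢a , y≢b) X∈ab X∈xy
            with LeftOf-total (λ { refl → Adjacent-irrefl G refl a~b }) x≢a x≢b
               | LeftOf-total (λ { refl → Adjacent-irrefl G refl a~b }) y≢a y≢b
          ... | inj₁ l | inj₁ l′ = segment-misses-line (LeftOf-positive l) (LeftOf-positive l′) X∈xy X∈ab
          ... | inj₂ r | inj₂ r′ = segment-misses-line (LeftOf-positive r) (LeftOf-positive r′) X∈xy (OnSegment-swap X∈ab)
          ... | inj₁ l | inj₂ r  = NonCrossing⇒same-side G nc a~b x~y l r
          ... | inj₂ r | inj₁ l  = NonCrossing⇒same-side G nc a~b (Adjacent-sym G x~y) l r

        -- The split is by which endpoints of the second edge belong to the first. With one, the
        -- edges meet only there; with none, they do not meet; with both, the edges coincide or the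
        -- second is a loop.
        NonCrossing⇒PlaneGraph : PlaneGraph p G
        NonCrossing⇒PlaneGraph {a} {b} {x} {y} a~b x~y different X X∈ab X∈xy
          with endpoint? a b x | endpoint? a b y
        ... | inj₁ x∈ab | inj₂ y∉ab = x , x∈ab , inj₁ refl , meet-at-common-end a~b x∈ab y∉ab X∈ab X∈xy
        ... | inj₂ x∉ab | inj₁ y∈ab = y , y∈ab , inj₂ refl , meet-at-common-end a~b y∈ab x∉ab X∈ab (OnSegment-swap X∈xy)
        ... | inj₂ x∉ab | inj₂ y∉ab = ⊥-elim (disjoint-edges-miss a~b x~y x∉ab y∉ab X∈ab X∈xy)
        ... | inj₁ (inj₁ refl) | inj₁ (inj₁ refl) = ⊥-elim (Adjacent-irrefl G refl x~y)
        ... | inj₁ (inj₁ refl) | inj₁ (inj₂ refl) = ⊥-elim (different (inj₁ (refl , refl)))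
        ... | inj₁ (inj₂ refl) | inj₁ (inj₁ refl) = ⊥-elim (different (inj₂ (refl , refl)))
        ... | inj₁ (inj₂ refl) | inj₁ (inj₂ refl) = ⊥-elim (Adjacent-irrefl G refl x~y)

  module _ {m} {p : Vector Point (suc m)} (convex : ConvexPosition p) where
    private
      inject₁-< : ∀ {a b : Fin m} → a Fin.< b → inject₁ a Fin.< inject₁ b
      inject₁-< {a} {b} = ≡.subst₂ ℕ._<_ (≡.sym (Fin.toℕ-inject₁ a)) (≡.sym (Fin.toℕ-inject₁ b))

      inject₁<fromℕ : ∀ (a : Fin m) → inject₁ a Fin.< fromℕ m
      inject₁<fromℕ a = ≡.subst₂ ℕ._<_ (≡.sym (Fin.toℕ-inject₁ a)) (≡.sym (Fin.toℕ-fromℕ m)) (Fin.toℕ<n a)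

    inject₁-convex : ConvexPosition (p ∘ inject₁)
    inject₁-convex = record
      { distinct = Fin.inject₁-injective ∘ ConvexPosition.distinct convex
      ; ccw      = λ a<b b<d → ConvexPosition.ccw convex (inject₁-< a<b) (inject₁-< b<d)
      }

    Visible : Graph m → Fin m → Set (c ⊔ ℓ₁ ⊔ ℓ₂)
    Visible G = VisibleFrom (p ∘ inject₁) G (p (fromℕ m))

    module _ (G : Graph m) {x : Fin m} where
      -- The additional point comes last, so an edge over `x` and the segment from `x` to that point
      -- are alternating chords.
      Visible⇒¬Covered : Visible G x → ¬ Covered G x
      Visible⇒¬Covered visible (a , b , a<x , x<b , a~b) =
        let X , X∈ab , X∈xq = chords-meet convex (inject₁-< a<x) (inject₁-< x<b) (inject₁<fromℕ b)
        in visible a~b (X , OnSegment-swap (InInterior⇒OnSegment X∈xq) , X∈ab)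

      private
        -- The additional point and an `x` outside the interval from `a` to `b` both lie to the left
        -- of the line from `a` to `b`.
        above-misses : ∀ {a b X} → a Fin.< b → x ≢ a → x ≢ b → ¬ (a Fin.< x × x Fin.< b) →
                       OnSegment (p (fromℕ m)) (p (inject₁ x)) X →
                       ¬ OnSegment (p (inject₁ a)) (p (inject₁ b)) X
        above-misses {a} {b} a<b x≢a x≢b x∉ab =
          segment-misses-line (LeftOf-positive convex (inj₁ (inject₁-< a<b , inject₁<fromℕ b)))
                              (LeftOf-positive convex left)
          where
          left : LeftOf (inject₁ a) (inject₁ b) (inject₁ x)
          left with Fin.<-cmp x a | Fin.<-cmp x b
          ... | tri< x<a _ _ | _            = inj₂ (inj₂ (inject₁-< x<a , inject₁-< a<b))
          ... | tri≈ _ e _   | _            = ⊥-elim (x≢a e)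
          ... | tri> _ _ a<x | tri< x<b _ _ = ⊥-elim (x∉ab (a<x , x<b))
          ... | tri> _ _ a<x | tri≈ _ e _   = ⊥-elim (x≢b e)
          ... | tri> _ _ a<x | tri> _ _ b<x = inj₁ (inject₁-< a<b , inject₁-< b<x)

      -- Isolation keeps `x` from being an end of the edge and lack of cover keeps it out of the
      -- interval, as `above-misses` requires.
      Exposed⇒Visible : Exposed G x → Visible G x
      Exposed⇒Visible (isolated , uncovered) {a} {b} a~b (X , X∈qx , X∈ab)
        with Fin.<-cmp a b
      ... | tri< a<b _ _ = above-misses a<b x≢a x≢b (λ (a<x , x<b) → uncovered (a , b , a<x , x<b , a~b))
                             X∈qx (InInterior⇒OnSegment X∈ab)
        where
        x≢a : x ≢ a
        x≢a refl = isolated b a~b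
        x≢b : x ≢ b
        x≢b refl = isolated a (Adjacent-sym G a~b)
      ... | tri≈ _ refl _ = Adjacent-irrefl G refl a~b
      ... | tri> _ _ b<a = above-misses b<a x≢b x≢a (λ (b<x , x<a) → uncovered (b , a , b<x , x<a , Adjacent-sym G a~b))
                             X∈qx (OnSegment-swap (InInterior⇒OnSegment X∈ab))
        where
        x≢a : x ≢ a
        x≢a refl = isolated b a~b
        x≢b : x ≢ b
        x≢b refl = isolated a (Adjacent-sym G a~b)

-- Counting

module _ {a p} {A : Set a} {P : Pred A p} where
  HasSize-unique : ∀ {q k l} {Q : Pred A q} → (∀ x → P x ⇔ Q x) → P HasSize k → Q HasSize l → k ≡ l
  HasSize-unique P⇔Q (xs , xs! , xs⇔ , refl) (ys , ys! , ys⇔ , refl) =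
    ↭-length (∼bag⇒↭ (unique∧set⇒bag xs! ys!
      (λ {x} → ⇔-sym (ys⇔ x) ⇔-∘ (P⇔Q x ⇔-∘ xs⇔ x))))

  HasSize-cong : ∀ {q k} {Q : Pred A q} → (∀ x → P x ⇔ Q x) → P HasSize k → Q HasSize k
  HasSize-cong P⇔Q (xs , xs! , xs⇔ , eq) = xs , xs! , (λ x → P⇔Q x ⇔-∘ xs⇔ x) , eq

  HasSize-image : ∀ {b q k} {B : Set b} {Q : Pred B q} (f : A → B) → (∀ {x y} → f x ≡ f y → x ≡ y) →
                  (∀ {x} → P x → Q (f x)) → (∀ {y} → Q y → ∃[ x ] P x × y ≡ f x) →
                  P HasSize k → Q HasSize k
  HasSize-image {Q = Q} f inj P⇒Q Q⇒P (xs , xs! , xs⇔ , refl) =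
    List.map f xs , Unique.map⁺ inj xs! , (λ y → mk⇔ to (from y)) , List.length-map f xs
    where
    to : ∀ {y} → y ∈ List.map f xs → Q y
    to y∈ with ∈-map⁻ f y∈
    ... | x , x∈xs , refl = P⇒Q (Equivalence.to (xs⇔ x) x∈xs)
    from : ∀ y → Q y → y ∈ List.map f xs
    from y qy with Q⇒P qy
    ... | x , px , refl = ∈-map⁺ f (Equivalence.from (xs⇔ x) px)

  HasSize-resp-≡ : ∀ {k l} → k ≡ l → P HasSize k → P HasSize l
  HasSize-resp-≡ refl size = size

  HasSize-0 : (∀ x → ¬ P x) → P HasSize 0
  HasSize-0 ¬P = [] , [] , (λ x → mk⇔ (λ ()) (⊥-elim ∘ ¬P x)) , refl

-- As each `x` is related to at most one `y`, the lists for different `y` are disjoint and may be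
-- concatenated. The recurrence uses this to sort graphs by the component of zero, by what remains
-- after its removal, and by the degree of what remains.
HasSize-fibres : ∀ {a b r} {A : Set a} {B : Set b} {R : A → B → Set r} {g : B → ℕ} →
                 (∀ {x y z} → R x y → R x z → y ≡ z) → ∀ {ys} → Unique ys →
                 (∀ {y} → y ∈ ys → (λ x → R x y) HasSize g y) →
                 (λ x → ∃[ y ] y ∈ ys × R x y) HasSize sum (List.map g ys)
HasSize-fibres functional {[]} [] sizes = HasSize-0 (λ { _ (_ , () , _) })
HasSize-fibres {R = R} functional {y ∷ ys} (y∉ys ∷ ys!) sizes
  with sizes (here refl) | HasSize-fibres functional ys! (sizes ∘ there)
... | us , us! , us⇔ , us-length | vs , vs! , vs⇔ , vs-length =
  us ++ vs , Unique.++⁺ us! vs! disjoint , (λ x → mk⇔ to from) ,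
  trans (List.length-++ us) (cong₂ _+_ us-length vs-length)
  where
  disjoint : ∀ {x} → ¬ (x ∈ us × x ∈ vs)
  disjoint {x} (x∈us , x∈vs) with Equivalence.to (vs⇔ x) x∈vs
  ... | z , z∈ys , rxz = All.lookup y∉ys z∈ys (functional (Equivalence.to (us⇔ x) x∈us) rxz)
  to : ∀ {x} → x ∈ us ++ vs → ∃[ z ] z ∈ y ∷ ys × R x z
  to {x} x∈ with ∈-++⁻ us x∈
  ... | inj₁ x∈us = y , here refl , Equivalence.to (us⇔ x) x∈us
  ... | inj₂ x∈vs with Equivalence.to (vs⇔ x) x∈vs
  ...   | z , z∈ys , rxz = z , there z∈ys , rxz
  from : ∀ {x} → (∃[ z ] z ∈ y ∷ ys × R x z) → x ∈ us ++ vs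
  from {x} (z , here refl , rxz)  = ∈-++⁺ˡ (Equivalence.from (us⇔ x) rxz)
  from {x} (z , there z∈ys , rxz) = ∈-++⁺ʳ us (Equivalence.from (vs⇔ x) (z , z∈ys , rxz))

sum-map-const : ∀ {b} {B : Set b} k (xs : List B) → sum (List.map (const k) xs) ≡ k * length xs
sum-map-const k []       = sym (ℕ.*-zeroʳ k)
sum-map-const k (x ∷ xs) = trans (cong (k +_) (sum-map-const k xs)) (sym (ℕ.*-suc k (length xs)))

∈-HasSize : ∀ {m} (S : Subset m) → (_∈ˢ S) HasSize ∣ S ∣
∈-HasSize [] = HasSize-0 (λ ())
∈-HasSize (outside ∷ S) = HasSize-image suc Fin.suc-injective there (λ { (there x∈S) → _ , x∈S , refl }) (∈-HasSize S)
∈-HasSize (inside ∷ S) with ∈-HasSize S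
... | xs , xs! , xs⇔ , eq =
  zero ∷ List.map suc xs , All.tabulate zero≢ ∷ Unique.map⁺ Fin.suc-injective xs! , (λ x → mk⇔ to from) ,
  cong suc (trans (List.length-map suc xs) eq)
  where
  zero≢ : ∀ {x} → x ∈ List.map suc xs → zero ≢ x
  zero≢ x∈ refl with ∈-map⁻ suc x∈
  ... | _ , _ , ()
  to : ∀ {x} → x ∈ zero ∷ List.map suc xs → x ∈ˢ inside ∷ S
  to (here refl) = here
  to (there x∈) with ∈-map⁻ suc x∈
  ... | y , y∈xs , refl = there (Equivalence.to (xs⇔ y) y∈xs)
  from : ∀ {x} → x ∈ˢ inside ∷ S → x ∈ zero ∷ List.map suc xs
  from here        = here refl
  from (there x∈S) = there (∈-map⁺ suc (Equivalence.from (xs⇔ _) x∈S))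

-- Enumeration of subsets

nonemptySubsets : ∀ {m} → Subset m → List (Subset m)
nonemptySubsets []            = []
nonemptySubsets (outside ∷ U) = List.map (outside ∷_) (nonemptySubsets U)
nonemptySubsets (inside ∷ U)  = List.map (outside ∷_) (nonemptySubsets U) ++
                                List.map (inside ∷_) (∅ˢ ∷ nonemptySubsets U)

-- The empty set is kept apart because it stands for an isolated zero, the only case in which zero
-- is exposed.
subsets : ∀ {m} → Subset m → List (Subset m)
subsets U = ∅ˢ ∷ nonemptySubsets U

∈-nonemptySubsets⁻ : ∀ {m} (U : Subset m) {S} → S ∈ nonemptySubsets U → Nonempty S × S ⊆ˢ U
∈-nonemptySubsets⁻ (outside ∷ U) S∈ with ∈-map⁻ (outside ∷_) S∈
... | S′ , S′∈ , refl with ∈-nonemptySubsets⁻ U S′∈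
...   | (x , x∈) , S′⊆U = (suc x , there x∈) , Subset.s⊆s S′⊆U
∈-nonemptySubsets⁻ (inside ∷ U) S∈ with ∈-++⁻ (List.map (outside ∷_) (nonemptySubsets U)) S∈
... | inj₁ S∈₁ with ∈-map⁻ (outside ∷_) S∈₁
...   | S′ , S′∈ , refl with ∈-nonemptySubsets⁻ U S′∈
...     | (x , x∈) , S′⊆U = (suc x , there x∈) , Subset.out⊆ S′⊆U
∈-nonemptySubsets⁻ (inside ∷ U) S∈ | inj₂ S∈₂ with ∈-map⁻ (inside ∷_) S∈₂
... | S′ , here refl , refl = (zero , here) , Subset.s⊆s (Subset.⊆-min U)
... | S′ , there S′∈ , refl = (zero , here) , Subset.s⊆s (proj₂ (∈-nonemptySubsets⁻ U S′∈))

∈-subsets⁻ : ∀ {m} (U : Subset m) {S} → S ∈ subsets U → S ⊆ˢ U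
∈-subsets⁻ U (here refl) = Subset.⊆-min U
∈-subsets⁻ U (there S∈)  = proj₂ (∈-nonemptySubsets⁻ U S∈)

∈-subsets⁺ : ∀ {m} (U : Subset m) {S} → S ⊆ˢ U → S ∈ subsets U
∈-nonemptySubsets⁺ : ∀ {m} (U : Subset m) {S} → Nonempty S → S ⊆ˢ U → S ∈ nonemptySubsets U

∈-subsets⁺ U {S} S⊆U with Subset.nonempty? S
... | yes nonempty = there (∈-nonemptySubsets⁺ U nonempty S⊆U)
... | no ¬nonempty = here (Subset.Empty-unique ¬nonempty)

∈-nonemptySubsets⁺ [] {[]} (() , _) _
∈-nonemptySubsets⁺ (outside ∷ U) {outside ∷ S} (suc x , there x∈S) S⊆U =
  ∈-map⁺ (outside ∷_) (∈-nonemptySubsets⁺ U (x , x∈S) (Subset.drop-∷-⊆ S⊆U))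
∈-nonemptySubsets⁺ (outside ∷ U) {inside ∷ S} _ S⊆U with S⊆U here
... | ()
∈-nonemptySubsets⁺ (inside ∷ U) {outside ∷ S} (suc x , there x∈S) S⊆U =
  ∈-++⁺ˡ (∈-map⁺ (outside ∷_) (∈-nonemptySubsets⁺ U (x , x∈S) (Subset.drop-∷-⊆ S⊆U)))
∈-nonemptySubsets⁺ (inside ∷ U) {inside ∷ S} _ S⊆U =
  ∈-++⁺ʳ (List.map (outside ∷_) (nonemptySubsets U))
    (∈-map⁺ (inside ∷_) (∈-subsets⁺ U (Subset.drop-∷-⊆ S⊆U)))

nonemptySubsets! : ∀ {m} (U : Subset m) → Unique (nonemptySubsets U)
subsets! : ∀ {m} (U : Subset m) → Unique (subsets U)

subsets! U = All.tabulate ∅≢ ∷ nonemptySubsets! U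
  where
  ∅≢ : ∀ {S} → S ∈ nonemptySubsets U → ∅ˢ ≢ S
  ∅≢ S∈ refl with ∈-nonemptySubsets⁻ U S∈
  ... | (x , x∈∅) , _ = Subset.∉⊥ x∈∅

nonemptySubsets! []            = []
nonemptySubsets! (outside ∷ U) = Unique.map⁺ Vec.∷-injectiveʳ (nonemptySubsets! U)
nonemptySubsets! (inside ∷ U)  = Unique.++⁺ (Unique.map⁺ Vec.∷-injectiveʳ (nonemptySubsets! U))
                                            (Unique.map⁺ Vec.∷-injectiveʳ (subsets! U)) disjoint
  where
  disjoint : ∀ {S} → ¬ (S ∈ List.map (outside ∷_) (nonemptySubsets U) × S ∈ List.map (inside ∷_) (subsets U))
  disjoint (S∈₁ , S∈₂) with ∈-map⁻ (outside ∷_) S∈₁ | ∈-map⁻ (inside ∷_) S∈₂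
  ... | _ , _ , refl | _ , _ , ()

-- The elements of `U` beyond all of `S`: a position is discarded exactly when `S` has an element
-- there or later.
after : ∀ {m} → Subset m → Subset m → Subset m
after []      []      = []
after (u ∷ U) (s ∷ S) = (if does (Subset.nonempty? (s ∷ S)) then outside else u) ∷ after U S

after-nonempty : ∀ {m} u (U : Subset m) s {S} → Nonempty (s ∷ S) → after (u ∷ U) (s ∷ S) ≡ outside ∷ after U S
after-nonempty u U s {S} nonempty rewrite dec-true (Subset.nonempty? (s ∷ S)) nonempty = refl

after-empty : ∀ {m} u (U : Subset m) s {S} → ¬ Nonempty (s ∷ S) → after (u ∷ U) (s ∷ S) ≡ u ∷ after U S
after-empty u U s {S} empty rewrite dec-false (Subset.nonempty? (s ∷ S)) empty = refl

after-∅ : ∀ {m} (U : Subset m) → after U ∅ˢ ≡ U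
after-∅ []      = refl
after-∅ (u ∷ U) = trans (after-empty u U outside {∅ˢ} (λ (x , x∈) → Subset.∉⊥ x∈)) (cong (u ∷_) (after-∅ U))

∈-after⁺ : ∀ {m} (U S : Subset m) {x} → x ∈ˢ U → (∀ {y} → y ∈ˢ S → y Fin.< x) → x ∈ˢ after U S
∈-after⁺ (u ∷ U) (s ∷ S) {zero} here below =
  ≡.subst (zero ∈ˢ_) (sym (after-empty u U s (λ (y , y∈) → ℕ.n≮0 (below y∈)))) here
∈-after⁺ (u ∷ U) (s ∷ S) {suc x} (there x∈U) below = there (∈-after⁺ U S x∈U (ℕ.s<s⁻¹ ∘ below ∘ there))

∈-after⁻ : ∀ {m} (U S : Subset m) {x} → x ∈ˢ after U S → x ∈ˢ U × (∀ {y} → y ∈ˢ S → y Fin.< x)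
∈-after⁻ (u ∷ U) (s ∷ S) {zero} x∈ = by-emptiness (Subset.nonempty? (s ∷ S))
  where
  by-emptiness : Dec (Nonempty (s ∷ S)) → zero ∈ˢ u ∷ U × (∀ {y} → y ∈ˢ s ∷ S → toℕ y ℕ.< 0)
  by-emptiness (yes nonempty) with ≡.subst (zero ∈ˢ_) (after-nonempty u U s nonempty) x∈
  ... | ()
  by-emptiness (no empty) with ≡.subst (zero ∈ˢ_) (after-empty u U s empty) x∈
  ... | here = here , λ y∈ → ⊥-elim (empty (_ , y∈))
∈-after⁻ (u ∷ U) (s ∷ S) {suc x} (there x∈) with ∈-after⁻ U S x∈
... | x∈U , below = there x∈U , λ { here → ℕ.z<s ; (there y∈) → ℕ.s<s (below y∈) }

-- Weighted sums over subsets

open SemiringSum ℕ.+-*-semiring using (sum-syntax; ∑-distrib-+; sum-cong-≗; sum-init-last)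

-- The total of `f ∣ T ∣` over all subsets `T` of a set with `r` elements.
binomialSum : ℕ → (ℕ → ℕ) → ℕ
binomialSum r f = ∑[ k < suc r ] ((r C toℕ k) * f (toℕ k))

-- Pascal's rule: the first summand collects the subsets without a fixed element, the second those
-- with it.
binomialSum-suc : ∀ r f → binomialSum (suc r) f ≡ binomialSum r f + binomialSum r (f ∘ suc)
binomialSum-suc r f = begin
  (suc r C 0) * f 0 + ∑[ k < suc r ] ((suc r C suc (toℕ k)) * f (suc (toℕ k)))
    ≡⟨ cong (1 * f 0 +_) (sum-cong-≗ {suc r} pascal) ⟩
  1 * f 0 + ∑[ k < suc r ] (g (toℕ k) + h (toℕ k))
    ≡⟨ cong (1 * f 0 +_) (∑-distrib-+ {suc r} (g ∘ toℕ) (h ∘ toℕ)) ⟩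
  1 * f 0 + (binomialSum r (f ∘ suc) + ∑[ k < suc r ] h (toℕ k))
    ≡⟨ cong (λ e → 1 * f 0 + (binomialSum r (f ∘ suc) + e)) drop-last ⟩
  1 * f 0 + (binomialSum r (f ∘ suc) + ∑[ k < r ] h (toℕ k))
    ≡⟨ cong (1 * f 0 +_) (ℕ.+-comm (binomialSum r (f ∘ suc)) _) ⟩
  1 * f 0 + (∑[ k < r ] h (toℕ k) + binomialSum r (f ∘ suc))    ≡⟨ ℕ.+-assoc (1 * f 0) _ _ ⟨
  binomialSum r f + binomialSum r (f ∘ suc)                     ∎
  where
  open ≡-Reasoning
  g h : ℕ → ℕ
  g k = (r C k) * f (suc k)
  h k = (r C suc k) * f (suc k)
  pascal : ∀ (k : Fin (suc r)) → (suc r C suc (toℕ k)) * f (suc (toℕ k)) ≡ g (toℕ k) + h (toℕ k)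
  pascal k = trans (cong (_* f (suc (toℕ k))) (sym (nCk+nC[k+1]≡[n+1]C[k+1] r (toℕ k))))
                   (ℕ.*-distribʳ-+ (f (suc (toℕ k))) (r C toℕ k) _)
  -- The surplus last term has the coefficient `r C suc r`, which is zero.
  drop-last : ∑[ k < suc r ] h (toℕ k) ≡ ∑[ k < r ] h (toℕ k)
  drop-last = begin
    ∑[ k < suc r ] h (toℕ k)                               ≡⟨ sum-init-last {r} (h ∘ toℕ) ⟩
    ∑[ k < r ] h (toℕ (inject₁ k)) + h (toℕ (fromℕ r))
      ≡⟨ cong₂ _+_ (sum-cong-≗ {r} (cong h ∘ Fin.toℕ-inject₁)) (cong h (Fin.toℕ-fromℕ r)) ⟩
    ∑[ k < r ] h (toℕ k) + h r
      ≡⟨ cong (λ e → ∑[ k < r ] h (toℕ k) + e * f (suc r)) (k>n⇒nCk≡0 (ℕ.n<1+n r)) ⟩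
    ∑[ k < r ] h (toℕ k) + 0                               ≡⟨ ℕ.+-identityʳ _ ⟩
    ∑[ k < r ] h (toℕ k)                                   ∎

-- In the application `U` is the exposed set of `G′`, `S` the component of zero, and `w k` the
-- number of connected plane graphs on zero and `k` further vertices.
weightAfter : ∀ {m} → (ℕ → ℕ) → ℕ → Subset m → Subset m → ℕ
weightAfter w p U S = if does (∣ after U S ∣ ℕ.≟ p) then w ∣ S ∣ else 0

-- Since the tail `S` is nonempty, `after` discards the first position whatever `u` and `s` are;
-- only the size of the set may shift, which `w′` absorbs.
sum-weightAfter-∷ : ∀ {m} w w′ p u (U : Subset m) s → (∀ (S : Subset m) → w ∣ s ∷ S ∣ ≡ w′ ∣ S ∣) →
  sum (List.map (weightAfter w p (u ∷ U)) (List.map (s ∷_) (nonemptySubsets U))) ≡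
  sum (List.map (weightAfter w′ p U) (nonemptySubsets U))
sum-weightAfter-∷ w w′ p u U s w≗w′ = trans (cong sum (sym (List.map-∘ (nonemptySubsets U))))
  (cong sum (List.map-cong-local (All.tabulate λ S∈ → tail-weight (proj₁ (∈-nonemptySubsets⁻ U S∈)))))
  where
  tail-weight : ∀ {S} → Nonempty S → weightAfter w p (u ∷ U) (s ∷ S) ≡ weightAfter w′ p U S
  tail-weight {S} (x , x∈S) = cong₂ (λ V k → if does (∣ V ∣ ℕ.≟ p) then k else 0)
    (after-nonempty u U s (suc x , there x∈S)) (w≗w′ S)

-- The last two terms account for the sets S that contain the first of the
-- suc q elements: S is a singleton or has further elements.
nonemptyWeight : (ℕ → ℕ) → ℕ → ℕ → ℕ
nonemptyWeight w p zero    = 0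
nonemptyWeight w p (suc q) =
  nonemptyWeight w p q + ((if does (q ℕ.≟ p) then w 1 else 0) + nonemptyWeight (w ∘ suc) p q)

-- Positions outside `U` change nothing, so only `∣ U ∣` matters. At a first position in `U`, the
-- sets that avoid it, its singleton, and the sets that contain it and more yield the three terms of
-- `nonemptyWeight`.
sum-weightAfter : ∀ {m} w p (U : Subset m) →
                  sum (List.map (weightAfter w p U) (nonemptySubsets U)) ≡ nonemptyWeight w p ∣ U ∣
sum-weightAfter w p [] = refl
sum-weightAfter w p (outside ∷ U) = begin
  sum (List.map (weightAfter w p (outside ∷ U)) (List.map (outside ∷_) (nonemptySubsets U)))
    ≡⟨ sum-weightAfter-∷ w w p outside U outside (λ _ → refl) ⟩
  sum (List.map (weightAfter w p U) (nonemptySubsets U))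
    ≡⟨ sum-weightAfter w p U ⟩
  nonemptyWeight w p ∣ U ∣                                                                    ∎
  where open ≡-Reasoning
sum-weightAfter {suc m} w p (inside ∷ U) = begin
  sum (List.map (weightAfter w p (inside ∷ U)) (nonemptySubsets (inside ∷ U)))
    ≡⟨ cong sum (List.map-++ _ (List.map (outside ∷_) (nonemptySubsets U)) _) ⟩
  sum (List.map (weightAfter w p (inside ∷ U)) (List.map (outside ∷_) (nonemptySubsets U)) ++ _)
    ≡⟨ sum-++ (List.map _ (List.map _ (nonemptySubsets U))) _ ⟩
  sum (List.map (weightAfter w p (inside ∷ U)) (List.map (outside ∷_) (nonemptySubsets U))) +
    (weightAfter w p (inside ∷ U) (inside ∷ ∅ˢ) +
     sum (List.map (weightAfter w p (inside ∷ U)) (List.map (inside ∷_) (nonemptySubsets U))))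
      ≡⟨ cong₂ _+_ (sum-weightAfter-∷ w w p inside U outside (λ _ → refl))
           (cong₂ _+_ singleton (sum-weightAfter-∷ w (w ∘ suc) p inside U inside (λ _ → refl))) ⟩
  sum (List.map (weightAfter w p U) (nonemptySubsets U)) +
    (w₁ + sum (List.map (weightAfter (w ∘ suc) p U) (nonemptySubsets U)))
      ≡⟨ cong₂ _+_ (sum-weightAfter w p U) (cong (w₁ +_) (sum-weightAfter (w ∘ suc) p U)) ⟩
  nonemptyWeight w p (suc ∣ U ∣) ∎
  where
  open ≡-Reasoning
  w₁ : ℕ
  w₁ = if does (∣ U ∣ ℕ.≟ p) then w 1 else 0
  singleton : weightAfter w p (inside ∷ U) (inside ∷ ∅ˢ) ≡ w₁
  singleton = cong₂ (λ V k → if does (∣ V ∣ ℕ.≟ p) then w (suc k) else 0) (after-∅ U) (Subset.∣⊥∣≡0 m)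

binomialSum-0 : ∀ f → binomialSum 0 f ≡ f 0
binomialSum-0 f = trans (ℕ.+-identityʳ _) (ℕ.+-identityʳ _)

-- Fewer than `q` of the `q` elements lie beyond a nonempty subset, hence never `p` of them.
nonemptyWeight-≤ : ∀ w {p q} → q ℕ.≤ p → nonemptyWeight w p q ≡ 0
nonemptyWeight-≤ w {p} {zero}  q≤p = refl
nonemptyWeight-≤ w {p} {suc q} q<p
  rewrite nonemptyWeight-≤ w (ℕ.<⇒≤ q<p) | nonemptyWeight-≤ (w ∘ suc) (ℕ.<⇒≤ q<p)
        | dec-false (q ℕ.≟ p) (ℕ.<⇒≢ q<p) = refl

-- The last element of `S` must be the one with exactly `p` elements beyond it, and the rest of `S`
-- is any subset of the `r` elements before it. The induction on `r` follows `binomialSum-suc`.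
nonemptyWeight-> : ∀ w p r → nonemptyWeight w p (suc (r + p)) ≡ binomialSum r (w ∘ suc)
nonemptyWeight-> w p zero
  rewrite nonemptyWeight-≤ w (ℕ.≤-refl {p}) | nonemptyWeight-≤ (w ∘ suc) (ℕ.≤-refl {p})
        | dec-true (p ℕ.≟ p) refl = trans (ℕ.+-identityʳ (w 1)) (sym (binomialSum-0 (w ∘ suc)))
nonemptyWeight-> w p (suc r)
  rewrite nonemptyWeight-> w p r | nonemptyWeight-> (w ∘ suc) p r
        | dec-false (suc (r + p) ℕ.≟ p) (ℕ.<⇒≢ (ℕ.s≤s (ℕ.m≤n+m p r)) ∘ sym) = sym (binomialSum-suc r (w ∘ suc))

-- The number of connected plane graphs on 1 + k vertices, where c₁ = 1 is not
-- supplied by c.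
connectedCount : (ℕ → ℕ) → ℕ → ℕ
connectedCount c zero    = 1
connectedCount c (suc k) = c (suc (suc k))

-- The indicator is the contribution of the empty `S`, which gives the subdiagonal; the other term
-- is that of the nonempty `S` and vanishes on and below the diagonal.
R-nonemptyWeight : ∀ c {n} (p q : Fin n) → R c n p q ≡
  (if does (suc (toℕ q) ℕ.≟ toℕ p) then 1 else 0) + nonemptyWeight (connectedCount c) (toℕ p) (toℕ q)
R-nonemptyWeight c {n} p q = by-order (toℕ p ℕ.<? toℕ q)
  where
  ind : ∀ {P : Set} → Dec P → ℕ
  ind P? = if does P? then 1 else 0
  above : ∀ p q → p ℕ.< q → coeff c ((q ∸ p) + 1) ≡ nonemptyWeight (connectedCount c) p q
  -- With `q = p + 1 + r` the index `q - p + 1` becomes `r + 2`, where `coeff c` is `binomialSum r`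
  -- of `c` shifted by two.
  above p q p<q with ℕ.m≤n⇒∃[o]m+o≡n p<q
  ... | r , refl
    rewrite sym (ℕ.+-suc p r) | ℕ.m+n∸m≡n p (suc r) | ℕ.+-comm r 1 | ℕ.+-suc p r | ℕ.+-comm p r =
    sym (nonemptyWeight-> (connectedCount c) p r)
  ind-flip : ∀ p q → Dec (p ≡ q) → ind (p ℕ.≟ q) ≡ ind (q ℕ.≟ p)
  ind-flip p q (yes e) rewrite dec-true (q ℕ.≟ p) (sym e) | dec-true (p ℕ.≟ q) e = refl
  ind-flip p q (no ¬e) rewrite dec-false (q ℕ.≟ p) (¬e ∘ sym) | dec-false (p ℕ.≟ q) ¬e = refl
  by-order : Dec (toℕ p ℕ.< toℕ q) →
             R c n p q ≡ ind (suc (toℕ q) ℕ.≟ toℕ p) + nonemptyWeight (connectedCount c) (toℕ p) (toℕ q)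
  by-order (yes p<q)
    rewrite dec-true (toℕ p ℕ.<? toℕ q) p<q | dec-false (suc (toℕ q) ℕ.≟ toℕ p) (ℕ.<⇒≢ (ℕ.m<n⇒m<1+n p<q) ∘ sym) =
    above (toℕ p) (toℕ q) p<q
  by-order (no p≮q)
    rewrite dec-false (toℕ p ℕ.<? toℕ q) p≮q | nonemptyWeight-≤ (connectedCount c) (ℕ.≮⇒≥ p≮q) =
    trans (ind-flip (toℕ p) (suc (toℕ q)) (toℕ p ℕ.≟ suc (toℕ q))) (sym (ℕ.+-identityʳ _))

-- The component of the root

Path : ∀ {m} → Graph m → Fin m → Fin m → Set
Path G = Star (Adjacent G)

Path-sym : ∀ {m} (G : Graph m) → Symmetric (Path G)
Path-sym G = Star.reverse (Adjacent-sym G)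

module _ {m} (N : Subset m) (G : Graph m) where
  private
    Attached : Fin m → Set
    Attached x = ∃[ n ] n ∈ˢ N × Path G n x

    -- Reachability in `N ◁ G` in terms of paths in `G`: a path between old vertices either avoids
    -- zero or can be cut at its first and last visit to zero, next to which it uses vertices of
    -- `N`. This lets `Path?` decide reachability by recursion on the graph.
    Linked : Fin (suc m) → Fin (suc m) → Set
    Linked zero    zero    = ⊤
    Linked zero    (suc b) = Attached b
    Linked (suc a) zero    = Attached a
    Linked (suc a) (suc b) = Path G a b ⊎ (Attached a × Attached b)

    Linked-refl : ∀ x → Linked x x
    Linked-refl zero    = tt
    Linked-refl (suc a) = inj₁ ε

    Linked-step : ∀ x y z → Adjacent (N ◁ G) x y → Linked y z → Linked x z
    Linked-step zero    (suc b) zero    b∈N _                 = tt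
    Linked-step zero    (suc b) (suc c) b∈N (inj₁ b⇝c)        = b , b∈N , b⇝c
    Linked-step zero    (suc b) (suc c) b∈N (inj₂ (_ , c-at)) = c-at
    Linked-step (suc a) zero    zero    a∈N _                 = a , a∈N , ε
    Linked-step (suc a) zero    (suc c) a∈N c-at              = inj₂ ((a , a∈N , ε) , c-at)
    Linked-step (suc a) (suc b) zero    a~b (n , n∈N , n⇝b)   = n , n∈N , n⇝b ◅◅ (Adjacent-sym G a~b ◅ ε)
    Linked-step (suc a) (suc b) (suc c) a~b (inj₁ b⇝c)        = inj₁ (a~b ◅ b⇝c)
    Linked-step (suc a) (suc b) (suc c) a~b (inj₂ ((n , n∈N , n⇝b) , c-at)) =
      inj₂ ((n , n∈N , n⇝b ◅◅ (Adjacent-sym G a~b ◅ ε)) , c-at)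

    Path⇒Linked : ∀ {x y} → Path (N ◁ G) x y → Linked x y
    Path⇒Linked {y = y} = Star.fold Linked (λ {x} {y} {z} → Linked-step x y z) (λ {x} → Linked-refl x)

    Attached⇒Path : ∀ {a} → Attached a → Path (N ◁ G) zero (suc a)
    Attached⇒Path (n , n∈N , n⇝a) = n∈N ◅ Star.gmap suc id n⇝a

    Linked⇒Path : ∀ x y → Linked x y → Path (N ◁ G) x y
    Linked⇒Path zero    zero    _                    = ε
    Linked⇒Path zero    (suc b) b-at                 = Attached⇒Path b-at
    Linked⇒Path (suc a) zero    a-at                 = Path-sym (N ◁ G) (Attached⇒Path a-at)
    Linked⇒Path (suc a) (suc b) (inj₁ a⇝b)           = Star.gmap suc id a⇝b
    Linked⇒Path (suc a) (suc b) (inj₂ (a-at , b-at)) =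
      Path-sym (N ◁ G) (Attached⇒Path a-at) ◅◅ Attached⇒Path b-at

    Linked? : (∀ a b → Dec (Path G a b)) → ∀ x y → Dec (Linked x y)
    Linked? path? = linked?
      where
      attached? : ∀ x → Dec (Attached x)
      attached? x = Fin.any? λ n → (n Subset.∈? N) ×-dec path? n x
      linked? : ∀ x y → Dec (Linked x y)
      linked? zero    zero    = yes tt
      linked? zero    (suc b) = attached? b
      linked? (suc a) zero    = attached? a
      linked? (suc a) (suc b) = path? a b ⊎-dec (attached? a ×-dec attached? b)

  Path?-◁ : (∀ a b → Dec (Path G a b)) → ∀ x y → Dec (Path (N ◁ G) x y)
  Path?-◁ path? x y = map′ (Linked⇒Path x y) Path⇒Linked (Linked? path? x y)

Path? : ∀ {m} (G : Graph m) a b → Dec (Path G a b)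
Path? (N ◁ G) = Path?-◁ N G (Path? G)

-- The increasing enumeration of `S`. Monotonicity carries the non-crossing condition through the
-- relabelling in both directions.
embed : ∀ {m} (S : Subset m) → Fin ∣ S ∣ → Fin m
embed (outside ∷ S) i       = suc (embed S i)
embed (inside ∷ S)  zero    = zero
embed (inside ∷ S)  (suc i) = suc (embed S i)

embed-∈ : ∀ {m} (S : Subset m) i → embed S i ∈ˢ S
embed-∈ (outside ∷ S) i       = there (embed-∈ S i)
embed-∈ (inside ∷ S)  zero    = here
embed-∈ (inside ∷ S)  (suc i) = there (embed-∈ S i)

embed-onto : ∀ {m} {S : Subset m} {x} → x ∈ˢ S → ∃[ i ] x ≡ embed S i
embed-onto {S = inside ∷ S}  here        = zero , refl
embed-onto {S = outside ∷ S} (there x∈S) = map₂ (cong suc) (embed-onto x∈S)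
embed-onto {S = inside ∷ S}  (there x∈S) with embed-onto x∈S
... | i , eq = suc i , cong suc eq

embed-mono : ∀ {m} (S : Subset m) {i j} → i Fin.< j → embed S i Fin.< embed S j
embed-mono (outside ∷ S)                   i<j       = ℕ.s<s (embed-mono S i<j)
embed-mono (inside ∷ S)  {zero}  {suc j} i<j       = ℕ.z<s
embed-mono (inside ∷ S)  {suc i} {suc j} (ℕ.s<s i<j) = ℕ.s<s (embed-mono S i<j)

embed-cancel-< : ∀ {m} (S : Subset m) {i j} → embed S i Fin.< embed S j → i Fin.< j
embed-cancel-< S {i} {j} ei<ej with Fin.<-cmp i j
... | tri< i<j _ _  = i<j
... | tri≈ _ refl _ = ⊥-elim (Fin.<-irrefl refl ei<ej)
... | tri> _ _ j<i  = ⊥-elim (Fin.<-asym ei<ej (embed-mono S j<i))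

embed-injective : ∀ {m} (S : Subset m) {i j} → embed S i ≡ embed S j → i ≡ j
embed-injective S {i} {j} eq with Fin.<-cmp i j
... | tri< i<j _ _ = ⊥-elim (Fin.<-irrefl eq (embed-mono S i<j))
... | tri≈ _ i≡j _ = i≡j
... | tri> _ _ j<i = ⊥-elim (Fin.<-irrefl (sym eq) (embed-mono S j<i))

module _ {m} (G : Graph (suc m)) where
  Rooted : Fin (suc m) → Set
  Rooted = Path G zero

  Rooted-step : ∀ {x y} → Adjacent G x y → Rooted x → Rooted y
  Rooted-step x~y 0⇝x = 0⇝x ◅◅ (x~y ◅ ε)

  opaque
    component : Subset m
    component = fromPred (Path? G zero ∘ suc)

    component⁺ : ∀ {x} → Rooted (suc x) → x ∈ˢ component
    component⁺ = ∈-fromPred⁺ (Path? G zero ∘ suc)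

    component⁻ : ∀ {x} → x ∈ˢ component → Rooted (suc x)
    component⁻ = ∈-fromPred⁻ (Path? G zero ∘ suc)

  Rooted⇒∈ : ∀ {x} → Rooted x → x ∈ˢ inside ∷ component
  Rooted⇒∈ {zero}  _   = here
  Rooted⇒∈ {suc x} 0⇝x = there (component⁺ 0⇝x)

  ∈⇒Rooted : ∀ {x} → x ∈ˢ inside ∷ component → Rooted x
  ∈⇒Rooted here       = ε
  ∈⇒Rooted (there x∈) = component⁻ x∈

  private
    -- Testing one end suffices, since adjacent vertices lie in the same component; for the same
    -- reason the relation is symmetric.
    Remaining : Fin m → Fin m → Set
    Remaining x y = Adjacent G (suc x) (suc y) × ¬ Rooted (suc x)

    Remaining? : ∀ x y → Dec (Remaining x y)
    Remaining? x y = Adjacent? G (suc x) (suc y) ×-dec ¬? (Path? G zero (suc x))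

    Remaining-sym : Symmetric Remaining
    Remaining-sym (x~y , ¬0⇝x) = Adjacent-sym G x~y , ¬0⇝x ∘ Rooted-step (Adjacent-sym G x~y)

  opaque
    removeComponent : Graph m
    removeComponent = fromRelation Remaining?

    removeComponent⁺ : ∀ {x y} → Adjacent G (suc x) (suc y) → ¬ Rooted (suc x) → Adjacent removeComponent x y
    removeComponent⁺ x~y ¬0⇝x =
      fromRelation⁺ Remaining? Remaining-sym (λ { refl (x~x , _) → Adjacent-irrefl G refl x~x }) (x~y , ¬0⇝x)

    removeComponent⁻ : ∀ {x y} → Adjacent removeComponent x y → Adjacent G (suc x) (suc y) × ¬ Rooted (suc x)
    removeComponent⁻ = fromRelation⁻ Remaining? Remaining-sym

  -- The first step of a path from zero that jumps past w covers w.
  jump-covers : ∀ {u w z} → Rooted u → u Fin.< w → w Fin.< z → ¬ Rooted w → Path G u z → Covered G w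
  jump-covers 0⇝u u<w w<z ¬0⇝w ε = ⊥-elim (Fin.<-asym u<w w<z)
  jump-covers {u} {w} 0⇝u u<w w<z ¬0⇝w (_◅_ {j = y} u~y y⇝z) with Fin.<-cmp y w
  ... | tri< y<w _ _  = jump-covers (Rooted-step u~y 0⇝u) y<w w<z ¬0⇝w y⇝z
  ... | tri≈ _ refl _ = ⊥-elim (¬0⇝w (Rooted-step u~y 0⇝u))
  ... | tri> _ _ w<y  = u , y , u<w , w<y , u~y

  module _ (nc : NonCrossing G) where
    -- Entering the interval spanned by an edge of another component would cross that edge.
    under-edge-unrooted : ∀ {a b z} → Adjacent G a b → ¬ Rooted a → a Fin.< z → z Fin.< b → ¬ Rooted z
    under-edge-unrooted {a} {b} {z} a~b ¬0⇝a a<z z<b =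
      enter ε (inj₁ (ℕ.≤∧≢⇒< ℕ.z≤n λ 0≡a → ¬0⇝a (≡.subst Rooted (Fin.toℕ-injective 0≡a) ε)))
      where
      enter : ∀ {u} → Rooted u → u Fin.< a ⊎ b Fin.< u → ¬ Path G u z
      enter 0⇝u (inj₁ u<a) ε = Fin.<-asym u<a a<z
      enter 0⇝u (inj₂ b<u) ε = Fin.<-asym b<u z<b
      enter 0⇝u out (_◅_ {j = y} u~y y⇝z) with Fin.<-cmp y a | Fin.<-cmp y b
      ... | tri< y<a _ _  | _             = enter (Rooted-step u~y 0⇝u) (inj₁ y<a) y⇝z
      ... | tri≈ _ refl _ | _             = ¬0⇝a (Rooted-step u~y 0⇝u)
      ... | tri> _ _ a<y  | tri≈ _ refl _ = ¬0⇝a (Rooted-step (Adjacent-sym G a~b) (Rooted-step u~y 0⇝u))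
      ... | tri> _ _ a<y  | tri> _ _ b<y  = enter (Rooted-step u~y 0⇝u) (inj₂ b<y) y⇝z
      ... | tri> _ _ a<y  | tri< y<b _ _ with out
      ...   | inj₁ u<a = nc u<a a<y y<b u~y a~b
      ...   | inj₂ b<u = nc a<y y<b b<u a~b (Adjacent-sym G u~y)

    removeComponent-NonCrossing : NonCrossing removeComponent
    removeComponent-NonCrossing a<b b<c c<d a~c b~d =
      nc (ℕ.s<s a<b) (ℕ.s<s b<c) (ℕ.s<s c<d) (proj₁ (removeComponent⁻ a~c)) (proj₁ (removeComponent⁻ b~d))

    -- The edges at the component are gone, and an edge that remains over `x` would belong to
    -- another component, below whose edges `under-edge-unrooted` admits no vertex connected to
    -- zero.
    component⊆exposed : component ⊆ˢ exposed removeComponent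
    component⊆exposed {x} x∈ = exposed⁺ removeComponent (isolated , uncovered)
      where
      isolated : Isolated removeComponent x
      isolated y x~y = proj₂ (removeComponent⁻ x~y) (component⁻ x∈)
      uncovered : ¬ Covered removeComponent x
      uncovered (a , b , a<x , x<b , a~b) with removeComponent⁻ a~b
      ... | a~b′ , ¬0⇝a = under-edge-unrooted a~b′ ¬0⇝a (ℕ.s<s a<x) (ℕ.s<s x<b) (component⁻ x∈)

    private
      Rooted⇒¬Isolated : ∀ {x} → Rooted (suc x) → ¬ Isolated G (suc x)
      Rooted⇒¬Isolated 0⇝x isolated with Path-sym G 0⇝x
      ... | x~y ◅ _ = isolated _ x~y

      exposed-zero⁺ : ¬ Nonempty component → zero ∈ˢ exposed G
      exposed-zero⁺ empty = exposed⁺ G (isolated , λ { (_ , _ , () , _) })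
        where
        isolated : Isolated G zero
        isolated zero    0~0 = Adjacent-irrefl G refl 0~0
        isolated (suc y) 0~y = empty (y , component⁺ (0~y ◅ ε))

      exposed-zero⁻ : zero ∈ˢ exposed G → ¬ Nonempty component
      exposed-zero⁻ 0∈ (x , x∈) with exposed⁻ G 0∈ | component⁻ x∈
      ... | isolated , _ | 0~y ◅ _ = isolated _ 0~y

      -- An edge of `G` over `x` either survives the removal or lies in the component of zero; in
      -- the latter case its end beyond `x` contradicts that the component stops before `x`.
      exposed-suc⁺ : ∀ {x} → x ∈ˢ after (exposed removeComponent) component → suc x ∈ˢ exposed G
      exposed-suc⁺ {x} x∈ with ∈-after⁻ (exposed removeComponent) component x∈
      ... | x∈exposed , above with exposed⁻ removeComponent x∈exposed
      ... | isolated , uncovered = exposed⁺ G (isolated′ , uncovered′)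
        where
        ¬0⇝x : ¬ Rooted (suc x)
        ¬0⇝x 0⇝x = Fin.<-irrefl refl (above (component⁺ 0⇝x))
        isolated′ : Isolated G (suc x)
        isolated′ zero    x~0 = ¬0⇝x (Rooted-step (Adjacent-sym G x~0) ε)
        isolated′ (suc y) x~y = isolated y (removeComponent⁺ x~y ¬0⇝x)
        uncovered′ : ¬ Covered G (suc x)
        uncovered′ (a , suc b , a<x , ℕ.s<s x<b , a~b) with Path? G zero a
        uncovered′ (a , suc b , a<x , ℕ.s<s x<b , a~b) | yes 0⇝a =
          Fin.<-asym x<b (above (component⁺ (Rooted-step a~b 0⇝a)))
        uncovered′ (zero , suc b , a<x , ℕ.s<s x<b , a~b) | no ¬0⇝a = ¬0⇝a ε
        uncovered′ (suc a , suc b , ℕ.s<s a<x , ℕ.s<s x<b , a~b) | no ¬0⇝a =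
          uncovered (a , b , a<x , x<b , removeComponent⁺ a~b ¬0⇝a)

      -- A component vertex beyond `x` would be reached by a path from zero that jumps over `x` and
      -- so covers it.
      exposed-suc⁻ : ∀ {x} → suc x ∈ˢ exposed G → x ∈ˢ after (exposed removeComponent) component
      exposed-suc⁻ {x} x∈ with exposed⁻ G x∈
      ... | isolated , uncovered = ∈-after⁺ (exposed removeComponent) component
        (exposed⁺ removeComponent
          ( (λ y x~y → isolated (suc y) (proj₁ (removeComponent⁻ x~y)))
          , (λ (a , b , a<x , x<b , a~b) →
               uncovered (suc a , suc b , ℕ.s<s a<x , ℕ.s<s x<b , proj₁ (removeComponent⁻ a~b)))))
        above
        where
        ¬0⇝x : ¬ Rooted (suc x)
        ¬0⇝x 0⇝x = Rooted⇒¬Isolated 0⇝x isolated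
        above : ∀ {y} → y ∈ˢ component → y Fin.< x
        above {y} y∈ with Fin.<-cmp y x
        ... | tri< y<x _ _  = y<x
        ... | tri≈ _ refl _ = ⊥-elim (¬0⇝x (component⁻ y∈))
        ... | tri> _ _ x<y  = ⊥-elim (uncovered (jump-covers ε ℕ.z<s (ℕ.s<s x<y) ¬0⇝x (component⁻ y∈)))

    -- The exposed set of `G` depends only on `component` and the exposed set of what remains. The
    -- first vertex is never covered, so zero is exposed exactly when `component` is empty.
    exposed-removeComponent : exposed G ≡
      (if does (Subset.nonempty? component) then outside else inside) ∷ after (exposed removeComponent) component
    exposed-removeComponent = Subset.⊆-antisym
      (λ { {zero} x∈ → to-zero (Subset.nonempty? component) x∈ ; {suc x} x∈ → there (exposed-suc⁻ x∈) })
      (λ { {zero} x∈ → from-zero (Subset.nonempty? component) x∈ ; {suc x} (there x∈) → exposed-suc⁺ x∈ })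
      where
      U : Subset m
      U = after (exposed removeComponent) component
      to-zero : (ne? : Dec (Nonempty component)) → zero ∈ˢ exposed G →
                zero ∈ˢ (if does ne? then outside else inside) ∷ U
      to-zero (yes ne) 0∈ = ⊥-elim (exposed-zero⁻ 0∈ ne)
      to-zero (no ¬ne) 0∈ = here
      from-zero : (ne? : Dec (Nonempty component)) → zero ∈ˢ (if does ne? then outside else inside) ∷ U →
                  zero ∈ˢ exposed G
      from-zero (no ¬ne) _ = exposed-zero⁺ ¬ne

-- Decomposing and gluing graphs

module _ {m} (S : Subset m) where
  private
    ι : Fin (suc ∣ S ∣) → Fin (suc m)
    ι = embed (inside ∷ S)

  opaque
    restrict : Graph (suc m) → Graph (suc ∣ S ∣)
    restrict G = fromRelation (λ a b → Adjacent? G (ι a) (ι b))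

    restrict⁺ : ∀ G {a b} → Adjacent G (ι a) (ι b) → Adjacent (restrict G) a b
    restrict⁺ G = fromRelation⁺ (λ a b → Adjacent? G (ι a) (ι b)) (Adjacent-sym G) (Adjacent-irrefl G ∘ cong ι)

    restrict⁻ : ∀ G {a b} → Adjacent (restrict G) a b → Adjacent G (ι a) (ι b)
    restrict⁻ G = fromRelation⁻ (λ a b → Adjacent? G (ι a) (ι b)) (Adjacent-sym G)

  module _ (G : Graph (suc m)) where
    restrict-NonCrossing : NonCrossing G → NonCrossing (restrict G)
    restrict-NonCrossing nc a<b b<c c<d a~c b~d =
      nc (embed-mono (inside ∷ S) a<b) (embed-mono (inside ∷ S) b<c) (embed-mono (inside ∷ S) c<d)
         (restrict⁻ G a~c) (restrict⁻ G b~d)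

    -- A path of `G` from zero never leaves the component, so all its vertices are in the image of
    -- `ι` and the path lifts to the restriction.
    restrict-Connected : S ≡ component G → Connected (restrict G)
    restrict-Connected refl a b = Path-sym (restrict G) (from-root a) ◅◅ from-root b
      where
      follow : ∀ {u z} i → u ≡ ι i → Rooted G u → Path G u z → ∃[ j ] z ≡ ι j × Path (restrict G) i j
      follow i u≡ 0⇝u ε = i , u≡ , ε
      follow i refl 0⇝u (u~y ◅ y⇝z) with embed-onto (Rooted⇒∈ G (Rooted-step G u~y 0⇝u))
      ... | k , refl with follow k refl (Rooted-step G u~y 0⇝u) y⇝z
      ...   | j , z≡ , k⇝j = j , z≡ , restrict⁺ G u~y ◅ k⇝j
      from-root : ∀ i → Path (restrict G) zero i
      from-root i with follow zero refl ε (∈⇒Rooted G (embed-∈ (inside ∷ S) i))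
      ... | j , eq , 0⇝j = ≡.subst (Path (restrict G) zero) (sym (embed-injective (inside ∷ S) eq)) 0⇝j

  module _ (G′ : Graph m) (H : Graph (suc ∣ S ∣)) where
    Glued : Fin (suc m) → Fin (suc m) → Set
    Glued x y = Adjacent (∅ˢ ◁ G′) x y ⊎ (∃[ a ] ∃[ b ] x ≡ ι a × y ≡ ι b × Adjacent H a b)

    Glued? : ∀ x y → Dec (Glued x y)
    Glued? x y = Adjacent? (∅ˢ ◁ G′) x y ⊎-dec
      Fin.any? λ a → Fin.any? λ b → (x Fin.≟ ι a) ×-dec (y Fin.≟ ι b) ×-dec Adjacent? H a b

    Glued-sym : Symmetric Glued
    Glued-sym {x} {y} (inj₁ x~y) = inj₁ (Adjacent-sym (∅ˢ ◁ G′) {x} {y} x~y)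
    Glued-sym (inj₂ (a , b , x≡ , y≡ , a~b)) = inj₂ (b , a , y≡ , x≡ , Adjacent-sym H a~b)

    Glued-irrefl : Irreflexive _≡_ Glued
    Glued-irrefl {x} refl (inj₁ x~x) = Adjacent-irrefl (∅ˢ ◁ G′) {x} refl x~x
    Glued-irrefl refl (inj₂ (a , b , x≡a , x≡b , a~b)) =
      Adjacent-irrefl H (embed-injective (inside ∷ S) (trans (sym x≡a) x≡b)) a~b

    opaque
      glue : Graph (suc m)
      glue = fromRelation Glued?

      glue⁺ : ∀ {x y} → Glued x y → Adjacent glue x y
      glue⁺ = fromRelation⁺ Glued? Glued-sym Glued-irrefl

      glue⁻ : ∀ {x y} → Adjacent glue x y → Glued x y
      glue⁻ = fromRelation⁻ Glued? Glued-sym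

  -- An edge of `G` has both ends in the component of zero, and is then kept by `restrict`, or
  -- neither, and is then kept by `removeComponent`.
  glue-restrict : ∀ G → S ≡ component G → glue (removeComponent G) (restrict G) ≡ G
  glue-restrict G refl =
    Graph-ext (forth ∘ glue⁻ (removeComponent G) (restrict G)) (glue⁺ (removeComponent G) (restrict G) ∘ back)
    where
    old : ∀ {x y} → Adjacent (∅ˢ ◁ removeComponent G) x y → Adjacent G x y
    old {zero}  {suc y} y∈∅ = ⊥-elim (Subset.∉⊥ y∈∅)
    old {suc x} {zero}  x∈∅ = ⊥-elim (Subset.∉⊥ x∈∅)
    old {suc x} {suc y} x~y = proj₁ (removeComponent⁻ G x~y)
    forth : ∀ {x y} → Glued (removeComponent G) (restrict G) x y → Adjacent G x y
    forth (inj₁ x~y)                         = old x~y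
    forth (inj₂ (a , b , refl , refl , a~b)) = restrict⁻ G a~b
    back : ∀ {x y} → Adjacent G x y → Glued (removeComponent G) (restrict G) x y
    back {x} {y} x~y with Path? G zero x
    back {x} {y} x~y | yes 0⇝x
      with embed-onto (Rooted⇒∈ G 0⇝x) | embed-onto (Rooted⇒∈ G (Rooted-step G x~y 0⇝x))
    ... | a , refl | b , refl = inj₂ (a , b , refl , refl , restrict⁺ G x~y)
    back {zero}          x~y | no ¬0⇝x = ⊥-elim (¬0⇝x ε)
    back {suc x} {zero}  x~y | no ¬0⇝x = ⊥-elim (¬0⇝x (Rooted-step G (Adjacent-sym G x~y) ε))
    back {suc x} {suc y} x~y | no ¬0⇝x = inj₁ (removeComponent⁺ G x~y ¬0⇝x)

  module _ {G′ : Graph m} (S⊆exposed : S ⊆ˢ exposed G′) where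
    private
      S-exposed : ∀ {x} → suc x ∈ˢ inside ∷ S → Exposed G′ x
      S-exposed (there x∈S) = exposed⁻ G′ (S⊆exposed x∈S)

      -- Hence an edge of a glued graph at zero or `S` can only come from `H`, never from `G′`.
      ι-isolated : ∀ i {y} → ¬ Adjacent (∅ˢ ◁ G′) (ι i) y
      ι-isolated i {y} i~y with ι i | embed-∈ (inside ∷ S) i
      ι-isolated i {suc y} i~y | zero  | _  = Subset.∉⊥ i~y
      ι-isolated i {zero}  i~y | suc x | _  = Subset.∉⊥ i~y
      ι-isolated i {suc y} i~y | suc x | x∈ = proj₁ (S-exposed x∈) y i~y

      ι-uncovered : ∀ i → ¬ Covered (∅ˢ ◁ G′) (ι i)
      ι-uncovered i (a , b , a<i , i<b , a~b) with ι i | embed-∈ (inside ∷ S) i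
      ι-uncovered i (zero  , suc b , a<i       , i<b       , a~b) | suc x | x∈ = Subset.∉⊥ a~b
      ι-uncovered i (suc a , suc b , ℕ.s<s a<i , ℕ.s<s i<b , a~b) | suc x | x∈ =
        proj₂ (S-exposed x∈) (a , b , a<i , i<b , a~b)

    glue-ι⁻ : ∀ H {a b} → Adjacent (glue G′ H) (ι a) (ι b) → Adjacent H a b
    glue-ι⁻ H {a} {b} a~b with glue⁻ G′ H a~b
    ... | inj₁ old = ⊥-elim (ι-isolated a old)
    ... | inj₂ (a′ , b′ , a≡ , b≡ , a′~b′)
      with embed-injective (inside ∷ S) {a} {a′} a≡ | embed-injective (inside ∷ S) {b} {b′} b≡
    ...   | refl | refl = a′~b′

    glue-injective : ∀ {H₁ H₂} → glue G′ H₁ ≡ glue G′ H₂ → H₁ ≡ H₂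
    glue-injective {H₁} {H₂} eq = Graph-ext (transfer eq) (transfer (sym eq))
      where
      transfer : ∀ {H₁ H₂} → glue G′ H₁ ≡ glue G′ H₂ → ∀ {a b} → Adjacent H₁ a b → Adjacent H₂ a b
      transfer {H₁} {H₂} eq {a} {b} a~b = glue-ι⁻ H₂
        (≡.subst (λ G → Adjacent G (ι a) (ι b)) eq (glue⁺ G′ H₁ (inj₂ (a , b , refl , refl , a~b))))

    module _ {H : Graph (suc ∣ S ∣)} where
      -- A crossing between an edge of `G′` and one of `H` would put an end of the latter under the
      -- former, but zero and the vertices of `S` are uncovered.
      glue-NonCrossing : NonCrossing G′ → NonCrossing H → NonCrossing (glue G′ H)
      glue-NonCrossing nc′ ncH a<b b<c c<d a~c b~d = cross a<b b<c c<d (glue⁻ G′ H a~c) (glue⁻ G′ H b~d)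
        where
        nc″ : NonCrossing (∅ˢ ◁ G′)
        nc″ {zero}  {_}     {suc c} _ _ _ c∈∅ _ = Subset.∉⊥ c∈∅
        nc″ {suc a} {suc b} {suc c} {suc d} (ℕ.s<s a<b) (ℕ.s<s b<c) (ℕ.s<s c<d) = nc′ a<b b<c c<d
        cross : ∀ {a b c d} → a Fin.< b → b Fin.< c → c Fin.< d → Glued G′ H a c → ¬ Glued G′ H b d
        cross a<b b<c c<d (inj₁ a~c) (inj₁ b~d) = nc″ a<b b<c c<d a~c b~d
        cross a<b b<c c<d (inj₁ a~c) (inj₂ (i , _ , refl , _ , _)) = ι-uncovered i (_ , _ , a<b , b<c , a~c)
        cross a<b b<c c<d (inj₂ (_ , j , _ , refl , _)) (inj₁ b~d) = ι-uncovered j (_ , _ , b<c , c<d , b~d)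
        cross a<b b<c c<d (inj₂ (_ , _ , refl , refl , i~k)) (inj₂ (_ , _ , refl , refl , j~l)) =
          ncH (embed-cancel-< (inside ∷ S) a<b) (embed-cancel-< (inside ∷ S) b<c)
              (embed-cancel-< (inside ∷ S) c<d) i~k j~l

      private
        stay : ∀ {u z} i → u ≡ ι i → Path (glue G′ H) u z → z ∈ˢ inside ∷ S
        stay i refl ε = embed-∈ (inside ∷ S) i
        stay i refl (u~y ◅ y⇝z) with glue⁻ G′ H u~y
        ... | inj₁ old = ⊥-elim (ι-isolated i old)
        ... | inj₂ (_ , j , _ , y≡ , _) = stay j y≡ y⇝z

        Rooted⇒∈S : ∀ {x} → Rooted (glue G′ H) (suc x) → x ∈ˢ S
        Rooted⇒∈S 0⇝x with stay zero refl 0⇝x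
        ... | there x∈S = x∈S

      -- Paths from zero use only edges of `H` and stay within zero and `S`; connectedness of `H`
      -- gives the converse.
      component-glue : Connected H → component (glue G′ H) ≡ S
      component-glue connected =
        Subset.⊆-antisym (Rooted⇒∈S ∘ component⁻ (glue G′ H)) (component⁺ (glue G′ H) ∘ ∈S⇒Rooted)
        where
        ∈S⇒Rooted : ∀ {x} → x ∈ˢ S → Rooted (glue G′ H) (suc x)
        ∈S⇒Rooted x∈S with embed-onto {S = inside ∷ S} (there x∈S)
        ... | i , eq = ≡.subst (Rooted (glue G′ H)) (sym eq)
          (Star.gmap ι (λ a~b → glue⁺ G′ H (inj₂ (_ , _ , refl , refl , a~b))) (connected zero i))

      -- Edges from `H` have their ends in the component and are removed. Edges of `G′` survive
      -- because the vertices of `S` are isolated in `G′`.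
      removeComponent-glue : Connected H → removeComponent (glue G′ H) ≡ G′
      removeComponent-glue connected = Graph-ext (forth ∘ removeComponent⁻ (glue G′ H)) back
        where
        forth : ∀ {x y} → Adjacent (glue G′ H) (suc x) (suc y) × ¬ Rooted (glue G′ H) (suc x) → Adjacent G′ x y
        forth (x~y , ¬0⇝x) with glue⁻ G′ H x~y
        ... | inj₁ old = old
        ... | inj₂ (i , _ , x≡ , _) = ⊥-elim (¬0⇝x (∈⇒Rooted (glue G′ H)
                (≡.subst₂ _∈ˢ_ (sym x≡) (cong (inside ∷_) (sym (component-glue connected))) (embed-∈ (inside ∷ S) i))))
        back : ∀ {x y} → Adjacent G′ x y → Adjacent (removeComponent (glue G′ H)) x y
        back {x} {y} x~y = removeComponent⁺ (glue G′ H) (glue⁺ G′ H (inj₁ x~y))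
          (λ 0⇝x → proj₁ (S-exposed (there (Rooted⇒∈S 0⇝x))) y x~y)

-- The recurrence

NonCrossingOfDegree : ∀ {m} → ℕ → Graph m → Set
NonCrossingOfDegree d G = NonCrossing G × ∣ exposed G ∣ ≡ d

NonCrossingConnected : ∀ {m} → Graph m → Set
NonCrossingConnected G = NonCrossing G × Connected G

exposed⇔ : ∀ {m} (G : Graph m) x → x ∈ˢ exposed G ⇔ Exposed G x
exposed⇔ G x = mk⇔ (exposed⁻ G) (exposed⁺ G)

module _ {c ℓ₁ ℓ₂} (F : OrderedField c ℓ₁ ℓ₂) where
  open Plane F
  open ConvexPositionProperties F

  ConnectedPlane⇔ : ∀ {m} {p : Vector Point m} → ConvexPosition p → ∀ G →
                    ConnectedPlane p G ⇔ NonCrossingConnected G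
  ConnectedPlane⇔ convex G = mk⇔
    (λ (plane , connected) → PlaneGraph⇒NonCrossing convex G plane , connected)
    (λ (nc , connected) → NonCrossing⇒PlaneGraph convex G nc , connected)

  -- `exposed` consists of the isolated visible vertices, and sizes are unique, so having isolation
  -- degree `d` amounts to an equation between numbers.
  PlaneOfDegree⇔ : ∀ {m} {p : Vector Point (suc m)} → ConvexPosition p → ∀ d G →
                   PlaneOfDegree p d G ⇔ NonCrossingOfDegree d G
  PlaneOfDegree⇔ {p = p} convex d G = mk⇔
    (λ (plane , size) → PlaneGraph⇒NonCrossing (inject₁-convex convex) G plane ,
                        HasSize-unique visible⇔ (∈-HasSize (exposed G)) size)
    (λ { (nc , refl) → (λ {_} {_} {_} {_} → NonCrossing⇒PlaneGraph (inject₁-convex convex) G nc) ,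
                       HasSize-cong visible⇔ (∈-HasSize (exposed G)) })
    where
    visible⇔ : ∀ x → x ∈ˢ exposed G ⇔ (Isolated G x × Visible convex G x)
    visible⇔ x = mk⇔ (λ e → proj₁ e , λ {_} {_} → Exposed⇒Visible convex G e)
                     (map₂ (Visible⇒¬Covered convex G))
                 ⇔-∘ exposed⇔ G x

degreeAfterGluing : ∀ {m} → Subset m → Subset m → ℕ
degreeAfterGluing U S = ∣ (if does (Subset.nonempty? S) then outside else inside) ∷ after U S ∣

gluingWeight : ∀ {m} → (ℕ → ℕ) → ℕ → Subset m → Subset m → ℕ
gluingWeight w p U S = if does (degreeAfterGluing U S ℕ.≟ p) then w ∣ S ∣ else 0

-- The empty `S` leaves zero exposed in addition to all of `U`, hence `suc ∣ U ∣`; for nonempty `S`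
-- zero is lost and the weight is `weightAfter`.
sum-gluingWeight : ∀ {m} w p (U : Subset m) → sum (List.map (gluingWeight w p U) (subsets U)) ≡
                   (if does (suc ∣ U ∣ ℕ.≟ p) then w 0 else 0) + nonemptyWeight w p ∣ U ∣
sum-gluingWeight {m} w p U = cong₂ _+_ empty
  (trans (cong sum (List.map-cong-local (All.tabulate λ S∈ → nonempty (proj₁ (∈-nonemptySubsets⁻ U S∈)))))
         (sum-weightAfter w p U))
  where
  empty : gluingWeight w p U ∅ˢ ≡ (if does (suc ∣ U ∣ ℕ.≟ p) then w 0 else 0)
  empty rewrite dec-false (Subset.nonempty? (∅ˢ {m})) (λ (x , x∈) → Subset.∉⊥ x∈) =
    cong₂ (λ V k → if does (suc ∣ V ∣ ℕ.≟ p) then w k else 0) (after-∅ U) (Subset.∣⊥∣≡0 m)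
  nonempty : ∀ {S} → Nonempty S → gluingWeight w p U S ≡ weightAfter w p U S
  nonempty {S} ne rewrite dec-true (Subset.nonempty? S) ne = refl

module _ {m} {G′ : Graph m} (nc′ : NonCrossing G′) where
  GluedFrom : Subset m → ℕ → Graph (suc m) → Set
  GluedFrom S p G = NonCrossingOfDegree p G × removeComponent G ≡ G′ × component G ≡ S

  GluedFrom-degree : ∀ {S p G} → GluedFrom S p G → degreeAfterGluing (exposed G′) S ≡ p
  GluedFrom-degree {G = G} ((nc , degree) , refl , refl) =
    trans (sym (cong ∣_∣ (exposed-removeComponent G nc))) degree

  -- For given `G′` and `S` all glued graphs have the same degree, so either none has degree `p`, or
  -- gluing is a bijection from the connected non-crossing graphs on `suc ∣ S ∣` vertices.
  GluedFrom-HasSize : ∀ {w p S} → S ⊆ˢ exposed G′ → NonCrossingConnected {suc ∣ S ∣} HasSize w ∣ S ∣ →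
                      GluedFrom S p HasSize gluingWeight w p (exposed G′) S
  GluedFrom-HasSize {w} {p} {S} S⊆ size = by-degree (degreeAfterGluing (exposed G′) S ℕ.≟ p)
    where
    by-degree : (d : Dec (degreeAfterGluing (exposed G′) S ≡ p)) →
                GluedFrom S p HasSize (if does d then w ∣ S ∣ else 0)
    by-degree (no ≢p) = HasSize-0 (λ G glued → ≢p (GluedFrom-degree glued))
    by-degree (yes refl) = HasSize-image (glue S G′) (glue-injective S S⊆) to from size
      where
      to : ∀ {H} → NonCrossingConnected H → GluedFrom S p (glue S G′ H)
      to {H} (nc , connected) = (glued-nc , degree) , remove≡ , component≡
        where
        glued-nc : NonCrossing (glue S G′ H)
        glued-nc = glue-NonCrossing S S⊆ nc′ nc
        remove≡ : removeComponent (glue S G′ H) ≡ G′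
        remove≡ = removeComponent-glue S S⊆ connected
        component≡ : component (glue S G′ H) ≡ S
        component≡ = component-glue S S⊆ connected
        degree : ∣ exposed (glue S G′ H) ∣ ≡ degreeAfterGluing (exposed G′) S
        degree = trans (cong ∣_∣ (exposed-removeComponent (glue S G′ H) glued-nc))
                       (cong₂ (λ G S → degreeAfterGluing (exposed G) S) remove≡ component≡)
      from : ∀ {G} → GluedFrom S p G → ∃[ H ] NonCrossingConnected H × G ≡ glue S G′ H
      from {G} ((nc , _) , refl , refl) =
        restrict S G , (restrict-NonCrossing S G nc , restrict-Connected S G refl) , sym (glue-restrict S G refl)

  -- Sorting by the component `S` leaves a count that depends on `G′` only through its number of
  -- exposed vertices; this is why a matrix can act on the degree vectors.
  removeComponent-fibre : ∀ {w} p → (∀ k → NonCrossingConnected {suc k} HasSize w k) →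
    (λ G → NonCrossingOfDegree p G × removeComponent G ≡ G′) HasSize
      ((if does (suc ∣ exposed G′ ∣ ℕ.≟ p) then w 0 else 0) + nonemptyWeight w p ∣ exposed G′ ∣)
  removeComponent-fibre {w} p sizes = HasSize-resp-≡ (sum-gluingWeight w p (exposed G′))
    (HasSize-cong (λ G → mk⇔ (λ (_ , _ , nc , remove≡ , _) → nc , remove≡) (to G))
      (HasSize-fibres {R = λ G S → GluedFrom S p G}
        (λ (_ , _ , e) (_ , _ , e′) → trans (sym e) e′) (subsets! (exposed G′))
        (λ {S} S∈ → GluedFrom-HasSize {w} (∈-subsets⁻ (exposed G′) S∈) (sizes ∣ S ∣))))
    where
    to : ∀ G → NonCrossingOfDegree p G × removeComponent G ≡ G′ → ∃[ S ] S ∈ subsets (exposed G′) × GluedFrom S p G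
    to G (ncd , refl) = component G , ∈-subsets⁺ (exposed G′) (component⊆exposed G (proj₁ ncd)) , ncd , refl , refl

sum-allFin : ∀ {n} (f : Fin n → ℕ) → sum (List.map f (allFin n)) ≡ SemiringSum.sum ℕ.+-*-semiring f
sum-allFin {n} f = trans (cong sum (List.map-tabulate id f)) (sum-tabulate f)
  where
  sum-tabulate : ∀ {n} (f : Fin n → ℕ) → sum (List.tabulate f) ≡ SemiringSum.sum ℕ.+-*-semiring f
  sum-tabulate {zero}  f = refl
  sum-tabulate {suc n} f = cong (f zero +_) (sum-tabulate (f ∘ suc))

-- This serves an isolated zero, since the values of `c` are given only from two vertices on.
NonCrossingConnected-1 : NonCrossingConnected {1} HasSize 1
NonCrossingConnected-1 = ([] ◁ ∅) ∷ [] , [] ∷ [] ,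
  (λ { ([] ◁ ∅) → mk⇔ (λ _ → (λ { {_} {zero} () }) , λ { zero zero → ε }) (λ _ → here refl) }) , refl

-- Graphs are sorted by the degree `q` of what remains without the component of zero, and each
-- column then by the remaining graph itself.
NonCrossingOfDegree-HasSize : ∀ {n m} c (v : Fin n → ℕ) → m ℕ.< n →
  (∀ k → NonCrossingConnected {suc k} HasSize connectedCount c k) →
  (∀ q → NonCrossingOfDegree {m} (toℕ q) HasSize v q) →
  ∀ p → NonCrossingOfDegree {suc m} (toℕ p) HasSize (R c n · v) p
NonCrossingOfDegree-HasSize {n} {m} c v m<n sizes v-sizes p =
  HasSize-resp-≡ (sum-allFin (λ q → R c n p q * v q))
    (HasSize-cong (λ G → mk⇔ (λ (_ , _ , ncd , _) → ncd) (to G))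
      (HasSize-fibres {R = λ G q → NonCrossingOfDegree (toℕ p) G × ∣ exposed (removeComponent G) ∣ ≡ toℕ q}
        (λ (_ , e) (_ , e′) → Fin.toℕ-injective (trans (sym e) e′)) (Unique.allFin⁺ n) (λ {q} _ → column q)))
  where
  to : ∀ G → NonCrossingOfDegree (toℕ p) G → ∃[ q ] q ∈ allFin n × NonCrossingOfDegree (toℕ p) G ×
       ∣ exposed (removeComponent G) ∣ ≡ toℕ q
  to G ncd = Fin.fromℕ< bound , ∈-allFin _ , ncd , sym (Fin.toℕ-fromℕ< bound)
    where
    -- A degree is at most the number `m` of vertices, so `m < n` makes it a valid column index.
    bound : ∣ exposed (removeComponent G) ∣ ℕ.< n
    bound = ℕ.≤-<-trans (Subset.∣p∣≤n (exposed (removeComponent G))) m<n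
  column : ∀ q → (λ G → NonCrossingOfDegree (toℕ p) G × ∣ exposed (removeComponent G) ∣ ≡ toℕ q)
                 HasSize (R c n p q * v q)
  -- Each of the `v q` graphs of degree `q` has the same number `R c n p q` of extensions.
  column q with v-sizes q
  ... | Gs , Gs! , Gs⇔ , length≡ = HasSize-resp-≡ (trans (sum-map-const (R c n p q) Gs) (cong (R c n p q *_) length≡))
    (HasSize-cong (λ G → mk⇔ forth back)
      (HasSize-fibres {R = λ G G′ → NonCrossingOfDegree (toℕ p) G × removeComponent G ≡ G′} {g = const (R c n p q)}
        (λ (_ , e) (_ , e′) → trans (sym e) e′) Gs! fibre))
    where
    forth : ∀ {G} → ∃[ G′ ] G′ ∈ Gs × NonCrossingOfDegree (toℕ p) G × removeComponent G ≡ G′ →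
            NonCrossingOfDegree (toℕ p) G × ∣ exposed (removeComponent G) ∣ ≡ toℕ q
    forth (G′ , G′∈ , ncd , refl) = ncd , proj₂ (Equivalence.to (Gs⇔ G′) G′∈)
    back : ∀ {G} → NonCrossingOfDegree (toℕ p) G × ∣ exposed (removeComponent G) ∣ ≡ toℕ q →
           ∃[ G′ ] G′ ∈ Gs × NonCrossingOfDegree (toℕ p) G × removeComponent G ≡ G′
    back {G} (ncd , degree) =
      removeComponent G , Equivalence.from (Gs⇔ _) (removeComponent-NonCrossing G (proj₁ ncd) , degree) , ncd , refl
    fibre : ∀ {G′} → G′ ∈ Gs → (λ G → NonCrossingOfDegree (toℕ p) G × removeComponent G ≡ G′) HasSize R c n p q
    fibre {G′} G′∈ with Equivalence.to (Gs⇔ G′) G′∈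
    ... | nc′ , degree = HasSize-resp-≡
      (trans (cong (λ d → (if does (suc d ℕ.≟ toℕ p) then 1 else 0) +
                          nonemptyWeight (connectedCount c) (toℕ p) d) degree)
             (sym (R-nonemptyWeight c p q)))
      (removeComponent-fibre nc′ {connectedCount c} (toℕ p) sizes)

theorem14 : ∀ {ℓ ℓ₁ ℓ₂} (F : OrderedField ℓ ℓ₁ ℓ₂) → let open Plane F in
    (P : ∀ m → Vector Point m) → (∀ m → ConvexPosition (P m)) →
    ∀ n → 3 ≤ n →
    (c : ℕ → ℕ) →
    (∀ i → 2 ≤ i → ConnectedPlane (P i) HasSize c i) →
    (v : ℕ → Vector ℕ n) →
    (∀ i → 1 ≤ i → i + 1 ≤ n → ∀ (j : Fin n) → PlaneOfDegree (P (suc i)) (toℕ j) HasSize v i j) →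
    ∀ i → 1 ≤ i → i + 2 ≤ n →
    ∀ (p : Fin n) → v (suc i) p ≡ (R c n · v i) p
theorem14 F P convex n 3≤n c c-sizes v v-sizes i 1≤i i+2≤n p =
  -- The point sets for different numbers of points are unrelated; the counts are compared through
  -- non-crossing graphs, which mention no points.
  HasSize-unique (PlaneOfDegree⇔ F (convex (suc (suc i))) (toℕ p))
    (v-sizes (suc i) ℕ.z<s (≡.subst (_≤ n) (ℕ.+-suc i 1) i+2≤n) p)
    (NonCrossingOfDegree-HasSize c (v i)
      (ℕ.≤-trans (≡.subst (_≤ i + 2) (ℕ.+-comm i 1) (ℕ.+-monoʳ-≤ i (ℕ.s≤s ℕ.z≤n))) i+2≤n)
      connected-sizes
      (λ q → HasSize-cong (PlaneOfDegree⇔ F (convex (suc i)) (toℕ q))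
        (v-sizes i 1≤i (ℕ.≤-trans (ℕ.+-monoʳ-≤ i (ℕ.s≤s ℕ.z≤n)) i+2≤n) q))
      p)
  where
  connected-sizes : ∀ k → NonCrossingConnected {suc k} HasSize connectedCount c k
  connected-sizes zero    = NonCrossingConnected-1
  connected-sizes (suc k) =
    HasSize-cong (ConnectedPlane⇔ F (convex (suc (suc k)))) (c-sizes (suc (suc k)) (ℕ.s≤s (ℕ.s≤s ℕ.z≤n)))
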